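{- Let $\varphi=\frac{1+\sqrt5}{2}$ and $\bar\varphi=\frac{1-\sqrt5}{2}$. Consider the two systems of functional equations for a map $f:\mathsf P^1(\mathbb Z)\to\mathsf P^1(\mathbb C)$: (A) $f(1-1/x)=1-1/f(x)$ and $f(-1/x)=-f(x)$ for all $x\in\mathsf P^1(\mathbb Z)$; (B) $f(1-1/x)=1-1/f(x)$ and $f(-1/(1+x))=-1-1/f(x)$ for all $x\in\mathsf P^1(\mathbb Z)$. Each of (A) and (B) has exactly two solutions, namely one with $f(1)=\varphi^2=\frac{3+\sqrt5}{2}$ and one with $f(1)=\bar\varphi^2=\frac{3-\sqrt5}{2}$.
   Context: $\mathsf P^1(\mathbb Z)=\mathbb Q\cup\{\infty\}$, $\mathsf P^1(\mathbb C)=\mathbb C\cup\{\infty\}$, with Möbius transformations extended to $\infty$ in the usual way. Interpretation: with Dyer's outer automorphism $\alpha$ of $\mathsf{PGL}_2(\mathbb Z)$ (defined by $\alpha(U)=U$, $\alpha(K)=K$, $\alpha(V)=UV$ where $U(x)=1/x$, $K(x)=1-x$, $V(x)=-x$), system (A) says $f(gx)=\alpha(g)f(x)$ for all $g\in\mathsf{PSL}_2(\mathbb Z)$, and system (B) says the same for all $g$ in $\Gamma=\langle L,SLS\rangle$, where $L(x)=1-1/x$, $S(x)=-1/x$. -}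

module Defs where

open import Data.Integer as ℤ using (+_)
import Data.Integer.Properties as ℤₚ
open import Data.Nat as ℕ using (ℕ; zero; suc)
import Data.Nat.Properties as ℕₚ
import Data.Nat.Solver as ℕS
open import Data.Product using (Σ; ∃; _×_; _,_; proj₁; proj₂)
open import Data.Rational as ℚ using (ℚ; 0ℚ; 1ℚ; ½; _+_; _*_; _-_; -_; ∣_∣; _≤_; _<_; 1/_; mkℚ; Positive)
open import Data.Rational.Properties as ℚₚ using (module ≤-Reasoning)
open import Data.Rational.Solver using (module +-*-Solver)
import Data.Rational.Unnormalised as ℚᵘ
import Data.Rational.Unnormalised.Properties as ℚᵘₚ
open import Data.Sum as Sum using (_⊎_; inj₁; inj₂; [_,_]′)
open import Function using (_∘_)
open import Relation.Binary.PropositionalEquality using (_≡_; refl; sym; trans; cong; cong₂; subst; subst₂)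
open import Relation.Nullary using (¬_; yes; no; contradiction)

private
  open +-*-Solver

  half-pos : ∀ {ε} → 0ℚ < ε → 0ℚ < ε * ½
  half-pos {ε} 0<ε = subst (_< ε * ½) (ℚₚ.*-zeroˡ ½) (ℚₚ.*-monoˡ-<-pos ½ 0<ε)

  half+half : ∀ ε → ε * ½ + ε * ½ ≡ ε
  half+half ε = trans (sym (ℚₚ.*-distribˡ-+ ε ½ ½)) (ℚₚ.*-identityʳ ε)

  +-pos : ∀ {p q} → 0ℚ < p → 0ℚ < q → 0ℚ < p + q
  +-pos {p} {q} 0<p 0<q = subst (_< p + q) (ℚₚ.+-identityˡ 0ℚ) (ℚₚ.+-mono-< 0<p 0<q)

  *-mono-≤-abs : ∀ p q {b d} → ∣ p ∣ ≤ b → ∣ q ∣ ≤ d → ∣ p * q ∣ ≤ b * d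
  *-mono-≤-abs p q {b} {d} p≤b q≤d = begin
    ∣ p * q ∣      ≡⟨ ℚₚ.∣p*q∣≡∣p∣*∣q∣ p q ⟩
    ∣ p ∣ * ∣ q ∣  ≤⟨ ℚₚ.*-monoʳ-≤-nonNeg ∣ q ∣ {{ℚₚ.∣-∣-nonNeg q}} p≤b ⟩
    b * ∣ q ∣      ≤⟨ ℚₚ.*-monoˡ-≤-nonNeg b {{ℚ.nonNegative (ℚₚ.≤-trans (ℚₚ.0≤∣p∣ p) p≤b)}} q≤d ⟩
    b * d          ∎
    where open ≤-Reasoning

  quot : ∀ ε B → 0ℚ < ε → 0ℚ < B → Σ ℚ λ δ → 0ℚ < δ × B * δ ≡ ε
  quot ε B 0<ε 0<B = ε * 1/B , pos , eq
    where
    instance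
      B⁺ : Positive B
      B⁺ = ℚ.positive 0<B
    1/B : ℚ
    1/B = (1/ B) {{ℚₚ.pos⇒nonZero B}}
    pos : 0ℚ < ε * 1/B
    pos = subst (_< ε * 1/B) (ℚₚ.*-zeroˡ 1/B) (ℚₚ.*-monoˡ-<-pos 1/B {{ℚₚ.1/pos⇒pos B}} 0<ε)
    eq : B * (ε * 1/B) ≡ ε
    eq = trans (solve 3 (λ b e c → b :* (e :* c) := e :* (b :* c)) refl B ε 1/B)
               (trans (cong (ε *_) (ℚₚ.*-inverseʳ B {{ℚₚ.pos⇒nonZero B}})) (ℚₚ.*-identityʳ ε))

  ∣a∣≤∣a-b∣+∣b∣ : ∀ a b → ∣ a ∣ ≤ ∣ a - b ∣ + ∣ b ∣
  ∣a∣≤∣a-b∣+∣b∣ a b = subst (λ t → ∣ t ∣ ≤ ∣ a - b ∣ + ∣ b ∣)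
    (solve 2 (λ a b → (a :- b) :+ b := a) refl a b) (ℚₚ.∣p+q∣≤∣p∣+∣q∣ (a - b) b)

  ∣a-b∣≡∣b-a∣ : ∀ a b → ∣ a - b ∣ ≡ ∣ b - a ∣
  ∣a-b∣≡∣b-a∣ a b = trans (sym (ℚₚ.∣-p∣≡∣p∣ (a - b)))
    (cong ∣_∣ (solve 2 (λ a b → :- (a :- b) := b :- a) refl a b))

  prod-diff : ∀ a b c d → a * b - c * d ≡ b * (a - c) + c * (b - d)
  prod-diff a b c d = solve 4 (λ a b c d → a :* b :- c :* d := b :* (a :- c) :+ c :* (b :- d)) refl a b c d

  +-cancelʳ-≤ : ∀ {a b} c → a + c ≤ b + c → a ≤ b
  +-cancelʳ-≤ {a} {b} c h = subst₂ _≤_ (e a) (e b) (ℚₚ.+-monoˡ-≤ (- c) h)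
    where
    e : ∀ a → (a + c) + (- c) ≡ a
    e a = solve 2 (λ a c → (a :+ c) :- c := a) refl a c

  abs-≤ : ∀ {p q} → p ≤ q → - p ≤ q → ∣ p ∣ ≤ q
  abs-≤ {p} {q} h₁ h₂ with ℚₚ.∣p∣≡p∨∣p∣≡-p p
  ... | inj₁ e = subst (_≤ q) (sym e) h₁
  ... | inj₂ e = subst (_≤ q) (sym e) h₂

-- Reals are Cauchy sequences of rationals, not quotiented: equality is _≈ᴿ_.
record ℝ : Set where
  constructor mkℝ
  field
    seq    : ℕ → ℚ
    cauchy : ∀ ε → 0ℚ < ε → ∃ λ N → ∀ m n → N ℕ.≤ m → N ℕ.≤ n → ∣ seq m - seq n ∣ ≤ ε

open ℝ public

infix 4 _≈ᴿ_
_≈ᴿ_ : ℝ → ℝ → Set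
x ≈ᴿ y = ∀ ε → 0ℚ < ε → ∃ λ N → ∀ n → N ℕ.≤ n → ∣ seq x n - seq y n ∣ ≤ ε

-- x is apart from 0: the positive form of x ≠ 0
infix 4 _#0ᴿ
_#0ᴿ : ℝ → Set
x #0ᴿ = Σ ℚ λ ε → 0ℚ < ε × ∃ λ N → ∀ n → N ℕ.≤ n → ε ≤ ∣ seq x n ∣

ratᴿ : ℚ → ℝ
ratᴿ q = mkℝ (λ _ → q) λ ε 0<ε → 0 , λ _ _ _ _ →
  subst (_≤ ε) (cong ∣_∣ (sym (ℚₚ.+-inverseʳ q))) (ℚₚ.<⇒≤ 0<ε)

infix  8 -ᴿ_
infixl 7 _*ᴿ_
infixl 6 _+ᴿ_ _-ᴿ_

_+ᴿ_ : ℝ → ℝ → ℝ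
x +ᴿ y = mkℝ (λ n → seq x n + seq y n) λ ε 0<ε →
  let (M , hx) = cauchy x (ε * ½) (half-pos 0<ε)
      (N , hy) = cauchy y (ε * ½) (half-pos 0<ε)
  in M ℕ.⊔ N , λ m n m≥ n≥ → begin
    ∣ (seq x m + seq y m) - (seq x n + seq y n) ∣
      ≡⟨ cong ∣_∣ (solve 4 (λ a b c d → (a :+ b) :- (c :+ d) := (a :- c) :+ (b :- d)) refl
           (seq x m) (seq y m) (seq x n) (seq y n)) ⟩
    ∣ (seq x m - seq x n) + (seq y m - seq y n) ∣
      ≤⟨ ℚₚ.∣p+q∣≤∣p∣+∣q∣ (seq x m - seq x n) (seq y m - seq y n) ⟩
    ∣ seq x m - seq x n ∣ + ∣ seq y m - seq y n ∣
      ≤⟨ ℚₚ.+-mono-≤ (hx m n (ℕₚ.m⊔n≤o⇒m≤o M N m≥) (ℕₚ.m⊔n≤o⇒m≤o M N n≥))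
                     (hy m n (ℕₚ.m⊔n≤o⇒n≤o M N m≥) (ℕₚ.m⊔n≤o⇒n≤o M N n≥)) ⟩
    ε * ½ + ε * ½ ≡⟨ half+half ε ⟩
    ε ∎
  where open ≤-Reasoning

-ᴿ_ : ℝ → ℝ
-ᴿ x = mkℝ (λ n → - seq x n) λ ε 0<ε →
  let (N , h) = cauchy x ε 0<ε
  in N , λ m n m≥ n≥ → subst (_≤ ε)
       (trans (sym (ℚₚ.∣-p∣≡∣p∣ (seq x m - seq x n)))
              (cong ∣_∣ (ℚₚ.neg-distrib-+ (seq x m) (- seq x n))))
       (h m n m≥ n≥)

_-ᴿ_ : ℝ → ℝ → ℝ
x -ᴿ y = x +ᴿ (-ᴿ y)

eventually-bounded : ∀ x → Σ ℚ λ B → 0ℚ < B × ∃ λ N → ∀ n → N ℕ.≤ n → ∣ seq x n ∣ ≤ B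
eventually-bounded x with cauchy x 1ℚ (ℚₚ.positive⁻¹ 1ℚ)
... | N , h = 1ℚ + ∣ seq x N ∣ , pos , N , λ n n≥ →
  ℚₚ.≤-trans (∣a∣≤∣a-b∣+∣b∣ (seq x n) (seq x N)) (ℚₚ.+-monoˡ-≤ ∣ seq x N ∣ (h n N n≥ ℕₚ.≤-refl))
  where
  pos : 0ℚ < 1ℚ + ∣ seq x N ∣
  pos = subst (_< 1ℚ + ∣ seq x N ∣) (ℚₚ.+-identityˡ 0ℚ)
          (ℚₚ.+-mono-<-≤ (ℚₚ.positive⁻¹ 1ℚ) (ℚₚ.0≤∣p∣ (seq x N)))

_*ᴿ_ : ℝ → ℝ → ℝ
x *ᴿ y = mkℝ (λ n → seq x n * seq y n) prf
  where
  prf : ∀ ε → 0ℚ < ε → ∃ λ N → ∀ m n → N ℕ.≤ m → N ℕ.≤ n →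
        ∣ seq x m * seq y m - seq x n * seq y n ∣ ≤ ε
  prf ε 0<ε =
    let (B , 0<B , M₁ , hB) = eventually-bounded x
        (C , 0<C , M₂ , hC) = eventually-bounded y
        (δ₁ , 0<δ₁ , e₁) = quot (ε * ½) C (half-pos 0<ε) 0<C
        (δ₂ , 0<δ₂ , e₂) = quot (ε * ½) B (half-pos 0<ε) 0<B
        (N₁ , hx) = cauchy x δ₁ 0<δ₁
        (N₂ , hy) = cauchy y δ₂ 0<δ₂
    in (M₁ ℕ.⊔ M₂) ℕ.⊔ (N₁ ℕ.⊔ N₂) , λ m n m≥ n≥ →
    let m≥M = ℕₚ.m⊔n≤o⇒m≤o (M₁ ℕ.⊔ M₂) (N₁ ℕ.⊔ N₂) m≥
        n≥M = ℕₚ.m⊔n≤o⇒m≤o (M₁ ℕ.⊔ M₂) (N₁ ℕ.⊔ N₂) n≥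
        m≥N = ℕₚ.m⊔n≤o⇒n≤o (M₁ ℕ.⊔ M₂) (N₁ ℕ.⊔ N₂) m≥
        n≥N = ℕₚ.m⊔n≤o⇒n≤o (M₁ ℕ.⊔ M₂) (N₁ ℕ.⊔ N₂) n≥
    in begin
    ∣ seq x m * seq y m - seq x n * seq y n ∣
      ≡⟨ cong ∣_∣ (prod-diff (seq x m) (seq y m) (seq x n) (seq y n)) ⟩
    ∣ seq y m * (seq x m - seq x n) + seq x n * (seq y m - seq y n) ∣
      ≤⟨ ℚₚ.∣p+q∣≤∣p∣+∣q∣ (seq y m * (seq x m - seq x n)) (seq x n * (seq y m - seq y n)) ⟩
    ∣ seq y m * (seq x m - seq x n) ∣ + ∣ seq x n * (seq y m - seq y n) ∣
      ≤⟨ ℚₚ.+-mono-≤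
           (*-mono-≤-abs (seq y m) (seq x m - seq x n) (hC m (ℕₚ.m⊔n≤o⇒n≤o M₁ M₂ m≥M))
              (hx m n (ℕₚ.m⊔n≤o⇒m≤o N₁ N₂ m≥N) (ℕₚ.m⊔n≤o⇒m≤o N₁ N₂ n≥N)))
           (*-mono-≤-abs (seq x n) (seq y m - seq y n) (hB n (ℕₚ.m⊔n≤o⇒m≤o M₁ M₂ n≥M))
              (hy m n (ℕₚ.m⊔n≤o⇒n≤o N₁ N₂ m≥N) (ℕₚ.m⊔n≤o⇒n≤o N₁ N₂ n≥N))) ⟩
    C * δ₁ + B * δ₂ ≡⟨ cong₂ _+_ e₁ e₂ ⟩
    ε * ½ + ε * ½   ≡⟨ half+half ε ⟩
    ε ∎
    where open ≤-Reasoning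

#0ᴿ-neg : ∀ x → x #0ᴿ → (-ᴿ x) #0ᴿ
#0ᴿ-neg x (ε , 0<ε , N , h) = ε , 0<ε , N , λ n n≥ →
  subst (ε ≤_) (sym (ℚₚ.∣-p∣≡∣p∣ (seq x n))) (h n n≥)

#0ᴿ-*ʳ : ∀ x y → (x *ᴿ y) #0ᴿ → y #0ᴿ
#0ᴿ-*ʳ x y (ε , 0<ε , N , h) =
  let (B , 0<B , M , hB) = eventually-bounded x
      (δ , 0<δ , e) = quot ε B 0<ε 0<B
  in δ , 0<δ , N ℕ.⊔ M , λ n n≥ → ℚₚ.*-cancelˡ-≤-pos B {{ℚ.positive 0<B}} (begin
    B * δ                 ≡⟨ e ⟩
    ε                     ≤⟨ h n (ℕₚ.m⊔n≤o⇒m≤o N M n≥) ⟩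
    ∣ seq x n * seq y n ∣ ≤⟨ *-mono-≤-abs (seq x n) (seq y n) (hB n (ℕₚ.m⊔n≤o⇒n≤o N M n≥)) ℚₚ.≤-refl ⟩
    B * ∣ seq y n ∣       ∎)
  where open ≤-Reasoning

#0ᴿ-cotrans : ∀ x y → x #0ᴿ → (y #0ᴿ) ⊎ ((y -ᴿ x) #0ᴿ)
#0ᴿ-cotrans x y (ε , 0<ε , N , h) with cauchy y δ 0<δ
  where
  δ : ℚ
  δ = ε * ½ * ½
  0<δ : 0ℚ < δ
  0<δ = half-pos (half-pos 0<ε)
... | M , hy with ε * ½ ℚₚ.≤? ∣ seq y M ∣
... | yes big = inj₁ (ε * ½ * ½ , half-pos (half-pos 0<ε) , M , λ n n≥ →
  +-cancelʳ-≤ (ε * ½ * ½) (begin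
    ε * ½ * ½ + ε * ½ * ½               ≡⟨ half+half (ε * ½) ⟩
    ε * ½                               ≤⟨ big ⟩
    ∣ seq y M ∣                         ≤⟨ ∣a∣≤∣a-b∣+∣b∣ (seq y M) (seq y n) ⟩
    ∣ seq y M - seq y n ∣ + ∣ seq y n ∣ ≤⟨ ℚₚ.+-monoˡ-≤ ∣ seq y n ∣ (hy M n ℕₚ.≤-refl n≥) ⟩
    ε * ½ * ½ + ∣ seq y n ∣             ≡⟨ ℚₚ.+-comm (ε * ½ * ½) ∣ seq y n ∣ ⟩
    ∣ seq y n ∣ + ε * ½ * ½             ∎))
  where open ≤-Reasoning
... | no small = inj₂ (ε * ½ * ½ , half-pos (half-pos 0<ε) , N ℕ.⊔ M , λ n n≥ →
  +-cancelʳ-≤ (ε * ½ * ½ + ε * ½) (begin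
    ε * ½ * ½ + (ε * ½ * ½ + ε * ½)     ≡⟨ sym (ℚₚ.+-assoc (ε * ½ * ½) (ε * ½ * ½) (ε * ½)) ⟩
    ε * ½ * ½ + ε * ½ * ½ + ε * ½       ≡⟨ cong (_+ ε * ½) (half+half (ε * ½)) ⟩
    ε * ½ + ε * ½                       ≡⟨ half+half ε ⟩
    ε                                   ≤⟨ h n (ℕₚ.m⊔n≤o⇒m≤o N M n≥) ⟩
    ∣ seq x n ∣                         ≤⟨ ∣a∣≤∣a-b∣+∣b∣ (seq x n) (seq y n) ⟩
    ∣ seq x n - seq y n ∣ + ∣ seq y n ∣ ≡⟨ cong (_+ ∣ seq y n ∣) (∣a-b∣≡∣b-a∣ (seq x n) (seq y n)) ⟩
    ∣ seq y n - seq x n ∣ + ∣ seq y n ∣ ≤⟨ ℚₚ.+-monoʳ-≤ ∣ seq y n - seq x n ∣ (yn≤ n n≥) ⟩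
    ∣ seq y n - seq x n ∣ + (ε * ½ * ½ + ε * ½) ∎))
  where
  open ≤-Reasoning
  yn≤ : ∀ n → N ℕ.⊔ M ℕ.≤ n → ∣ seq y n ∣ ≤ ε * ½ * ½ + ε * ½
  yn≤ n n≥ = ℚₚ.≤-trans (∣a∣≤∣a-b∣+∣b∣ (seq y n) (seq y M))
    (ℚₚ.+-mono-≤ (hy n M (ℕₚ.m⊔n≤o⇒n≤o N M n≥) ℕₚ.≤-refl) (ℚₚ.<⇒≤ (ℚₚ.≰⇒> small)))

⌊√_⌋ : ℕ → ℕ
⌊√ zero ⌋ = 0
⌊√ suc n ⌋ with suc ⌊√ n ⌋ ℕ.* suc ⌊√ n ⌋ ℕ.≤? suc n
... | yes _ = suc ⌊√ n ⌋
... | no  _ = ⌊√ n ⌋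

⌊√⌋-spec : ∀ n → ⌊√ n ⌋ ℕ.* ⌊√ n ⌋ ℕ.≤ n × n ℕ.< suc ⌊√ n ⌋ ℕ.* suc ⌊√ n ⌋
⌊√⌋-spec zero = ℕ.z≤n , ℕ.s≤s ℕ.z≤n
⌊√⌋-spec (suc n) with suc ⌊√ n ⌋ ℕ.* suc ⌊√ n ⌋ ℕ.≤? suc n
... | yes p = p , ℕₚ.≤-<-trans (proj₂ (⌊√⌋-spec n))
                    (ℕₚ.*-mono-< (ℕₚ.n<1+n (suc ⌊√ n ⌋)) (ℕₚ.n<1+n (suc ⌊√ n ⌋)))
... | no ¬p = ℕₚ.m≤n⇒m≤1+n (proj₁ (⌊√⌋-spec n)) , ℕₚ.≰⇒> ¬p

-- The largest a / (n + 1) with a / (n + 1) ≤ √k, so within 1 / (n + 1) of √k.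
√-approx : ℕ → ℕ → ℚ
√-approx k n = + ⌊√ k ℕ.* (suc n ℕ.* suc n) ⌋ ℚ./ suc n

private
  √-cross : ∀ k m n →
    ⌊√ k ℕ.* (suc m ℕ.* suc m) ⌋ ℕ.* suc n ℕ.≤ suc ⌊√ k ℕ.* (suc n ℕ.* suc n) ⌋ ℕ.* suc m
  √-cross k m n = ℕₚ.≮⇒≥ λ lt → ℕₚ.<-irrefl refl (begin-strict
    (t ℕ.* M) ℕ.* (t ℕ.* M)     <⟨ ℕₚ.*-mono-< lt lt ⟩
    (r ℕ.* N) ℕ.* (r ℕ.* N)     ≡⟨ S.solve 2 (λ r N → (r S.:* N) S.:* (r S.:* N) S.:= (r S.:* r) S.:* (N S.:* N)) refl r N ⟩
    (r ℕ.* r) ℕ.* (N ℕ.* N)     ≤⟨ ℕₚ.*-monoˡ-≤ (N ℕ.* N) (proj₁ (⌊√⌋-spec (k ℕ.* (M ℕ.* M)))) ⟩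
    k ℕ.* (M ℕ.* M) ℕ.* (N ℕ.* N) ≡⟨ S.solve 3 (λ k M N → k S.:* (M S.:* M) S.:* (N S.:* N) S.:= k S.:* (N S.:* N) S.:* (M S.:* M)) refl k M N ⟩
    k ℕ.* (N ℕ.* N) ℕ.* (M ℕ.* M) ≤⟨ ℕₚ.*-monoˡ-≤ (M ℕ.* M) (ℕₚ.<⇒≤ (proj₂ (⌊√⌋-spec (k ℕ.* (N ℕ.* N))))) ⟩
    (t ℕ.* t) ℕ.* (M ℕ.* M)     ≡⟨ S.solve 2 (λ r N → (r S.:* r) S.:* (N S.:* N) S.:= (r S.:* N) S.:* (r S.:* N)) refl t M ⟩
    (t ℕ.* M) ℕ.* (t ℕ.* M)     ∎)
    where
    open ℕₚ.≤-Reasoning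
    module S = ℕS.+-*-Solver
    M N r t : ℕ
    M = suc m
    N = suc n
    r = ⌊√ k ℕ.* (M ℕ.* M) ⌋
    t = suc ⌊√ k ℕ.* (N ℕ.* N) ⌋

  frac-≤ : ∀ a b c d → a ℕ.* suc d ℕ.≤ suc c ℕ.* suc b →
           + a ℚ./ suc b ≤ + c ℚ./ suc d + + 1 ℚ./ suc d
  frac-≤ a b c d h = ℚₚ.toℚᵘ-cancel-≤ (begin
    ℚ.toℚᵘ (+ a ℚ./ suc b)               ≃⟨ ℚₚ.toℚᵘ-fromℚᵘ (ℚᵘ.mkℚᵘ (+ a) b) ⟩
    ℚᵘ.mkℚᵘ (+ a) b                      ≤⟨ ℚᵘ.*≤* step ⟩
    ℚᵘ.mkℚᵘ (+ suc c) d                  ≃⟨ ℚᵘ.*≡* merge ⟩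
    ℚᵘ.mkℚᵘ (+ c) d ℚᵘ.+ ℚᵘ.mkℚᵘ (+ 1) d
      ≃⟨ ℚᵘₚ.+-cong (ℚᵘₚ.≃-sym (ℚₚ.toℚᵘ-fromℚᵘ (ℚᵘ.mkℚᵘ (+ c) d)))
                    (ℚᵘₚ.≃-sym (ℚₚ.toℚᵘ-fromℚᵘ (ℚᵘ.mkℚᵘ (+ 1) d))) ⟩
    ℚ.toℚᵘ (+ c ℚ./ suc d) ℚᵘ.+ ℚ.toℚᵘ (+ 1 ℚ./ suc d)
      ≃⟨ ℚᵘₚ.≃-sym (ℚₚ.toℚᵘ-homo-+ (+ c ℚ./ suc d) (+ 1 ℚ./ suc d)) ⟩
    ℚ.toℚᵘ (+ c ℚ./ suc d + + 1 ℚ./ suc d) ∎)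
    where
    open ℚᵘₚ.≤-Reasoning
    step : + a ℤ.* + suc d ℤ.≤ + suc c ℤ.* + suc b
    step = subst₂ ℤ._≤_ (ℤₚ.pos-* a (suc d)) (ℤₚ.pos-* (suc c) (suc b)) (ℤ.+≤+ h)
    merge : + suc c ℤ.* + (suc d ℕ.* suc d) ≡ (+ c ℤ.* + suc d ℤ.+ + 1 ℤ.* + suc d) ℤ.* + suc d
    merge = trans (cong (+ suc c ℤ.*_) (ℤₚ.pos-* (suc d) (suc d)))
      (trans (sym (ℤₚ.*-assoc (+ suc c) (+ suc d) (+ suc d)))
        (cong (ℤ._* + suc d)
          (trans (cong (ℤ._* + suc d) (cong +_ (ℕₚ.+-comm 1 c)))
                 (ℤₚ.*-distribʳ-+ (+ suc d) (+ c) (+ 1)))))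

  archimedean : ∀ ε → 0ℚ < ε → ∃ λ N → ∀ n → N ℕ.≤ n → + 1 ℚ./ suc n ≤ ε
  archimedean (mkℚ (+ zero) d c) 0<ε = contradiction (ℚ.positive 0<ε) λ ()
  archimedean (mkℚ ℤ.-[1+ p ] d c) 0<ε = contradiction (ℚ.positive 0<ε) λ ()
  archimedean (mkℚ ℤ.+[1+ p ] d c) 0<ε = d , λ n d≤n → ℚₚ.toℚᵘ-cancel-≤
    (ℚᵘₚ.≤-respˡ-≃ (ℚᵘₚ.≃-sym (ℚₚ.toℚᵘ-fromℚᵘ (ℚᵘ.mkℚᵘ (+ 1) n)))
      (ℚᵘ.*≤* (subst₂ ℤ._≤_ (ℤₚ.pos-* 1 (suc d)) (ℤₚ.pos-* (suc p) (suc n))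
        (ℤ.+≤+ (ℕₚ.*-mono-≤ {1} {suc p} (ℕ.s≤s ℕ.z≤n) (ℕ.s≤s d≤n))))))

√-approx-≤ : ∀ k m n → √-approx k m ≤ √-approx k n + + 1 ℚ./ suc n
√-approx-≤ k m n = frac-≤ ⌊√ k ℕ.* (suc m ℕ.* suc m) ⌋ m ⌊√ k ℕ.* (suc n ℕ.* suc n) ⌋ n (√-cross k m n)

√_ : ℕ → ℝ
√ k = mkℝ (√-approx k) prf
  where
  diff : ∀ {a b e ε} → a ≤ b + e → e ≤ ε → a - b ≤ ε
  diff {a} {b} {e} {ε} h e≤ε = ℚₚ.≤-trans
    (subst (a - b ≤_) (solve 2 (λ b e → (b :+ e) :- b := e) refl b e) (ℚₚ.+-monoˡ-≤ (- b) h)) e≤ε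
  prf : ∀ ε → 0ℚ < ε → ∃ λ N → ∀ m n → N ℕ.≤ m → N ℕ.≤ n → ∣ √-approx k m - √-approx k n ∣ ≤ ε
  prf ε 0<ε with archimedean ε 0<ε
  ... | N , h = N , λ m n m≥ n≥ → abs-≤
    (diff (√-approx-≤ k m n) (h n n≥))
    (subst (_≤ ε) (solve 2 (λ a b → b :- a := :- (a :- b)) refl (√-approx k m) (√-approx k n))
      (diff (√-approx-≤ k n m) (h m m≥)))

infix 4 _+i_
record ℂ : Set where
  constructor _+i_
  field
    re im : ℝ

open ℂ public

infix 4 _≈ᶜ_
_≈ᶜ_ : ℂ → ℂ → Set
z ≈ᶜ w = (re z ≈ᴿ re w) × (im z ≈ᴿ im w)

infix 4 _#0
_#0 : ℂ → Set
z #0 = (re z #0ᴿ) ⊎ (im z #0ᴿ)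

real : ℝ → ℂ
real x = x +i ratᴿ 0ℚ

rat : ℚ → ℂ
rat q = real (ratᴿ q)

0ᶜ 1ᶜ : ℂ
0ᶜ = rat 0ℚ
1ᶜ = rat 1ℚ

infix  8 -ᶜ_
infixl 7 _*ᶜ_
infixl 6 _+ᶜ_ _-ᶜ_

_+ᶜ_ _-ᶜ_ _*ᶜ_ : ℂ → ℂ → ℂ
z +ᶜ w = (re z +ᴿ re w) +i (im z +ᴿ im w)
z -ᶜ w = (re z -ᴿ re w) +i (im z -ᴿ im w)
z *ᶜ w = (re z *ᴿ re w -ᴿ im z *ᴿ im w) +i (re z *ᴿ im w +ᴿ im z *ᴿ re w)

-ᶜ_ : ℂ → ℂ
-ᶜ z = (-ᴿ re z) +i (-ᴿ im z)

1#0 : 1ᶜ #0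
1#0 = inj₁ (1ℚ , ℚₚ.positive⁻¹ 1ℚ , 0 , λ _ _ → ℚₚ.≤-refl)

#0-neg : ∀ z → z #0 → (-ᶜ z) #0
#0-neg z (inj₁ p) = inj₁ (#0ᴿ-neg (re z) p)
#0-neg z (inj₂ p) = inj₂ (#0ᴿ-neg (im z) p)

#0-cotrans : ∀ z w → z #0 → (w #0) ⊎ ((w -ᶜ z) #0)
#0-cotrans z w (inj₁ p) = Sum.map inj₁ inj₁ (#0ᴿ-cotrans (re z) (re w) p)
#0-cotrans z w (inj₂ p) = Sum.map inj₂ inj₂ (#0ᴿ-cotrans (im z) (im w) p)

private
  #0ᴿ-neg⁻¹ : ∀ x → (-ᴿ x) #0ᴿ → x #0ᴿ
  #0ᴿ-neg⁻¹ x (ε , 0<ε , N , h) = ε , 0<ε , N , λ n n≥ →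
    subst (ε ≤_) (ℚₚ.∣-p∣≡∣p∣ (seq x n)) (h n n≥)

  #0ᴿ-+ : ∀ x y → (x +ᴿ y) #0ᴿ → (x #0ᴿ) ⊎ (y #0ᴿ)
  #0ᴿ-+ x y p = Sum.map₂ rest (#0ᴿ-cotrans (x +ᴿ y) x p)
    where
    rest : (x -ᴿ (x +ᴿ y)) #0ᴿ → y #0ᴿ
    rest (ε , 0<ε , N , h) = ε , 0<ε , N , λ n n≥ → subst (ε ≤_)
      (trans (cong ∣_∣ (solve 2 (λ a b → a :- (a :+ b) := :- b) refl (seq x n) (seq y n)))
             (ℚₚ.∣-p∣≡∣p∣ (seq y n)))
      (h n n≥)

#0-*ʳ : ∀ z w → (z *ᶜ w) #0 → w #0
#0-*ʳ z w (inj₁ p) =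
  Sum.map (#0ᴿ-*ʳ (re z) (re w)) (#0ᴿ-*ʳ (im z) (im w) ∘ #0ᴿ-neg⁻¹ (im z *ᴿ im w))
    (#0ᴿ-+ (re z *ᴿ re w) (-ᴿ (im z *ᴿ im w)) p)
#0-*ʳ z w (inj₂ p) =
  Sum.swap (Sum.map (#0ᴿ-*ʳ (re z) (im w)) (#0ᴿ-*ʳ (im z) (re w))
    (#0ᴿ-+ (re z *ᴿ im w) (im z *ᴿ re w) p))

φ φ̄ : ℂ
φ = rat ½ *ᶜ (1ᶜ +ᶜ real (√ 5))
φ̄ = rat ½ *ᶜ (1ᶜ -ᶜ real (√ 5))

data P¹ℤ : Set where
  fin : ℚ → P¹ℤ
  ∞   : P¹ℤ

infix  8 ⊝_ inv_
infixl 6 _⊕_ _⊖_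

⊝_ inv_ : P¹ℤ → P¹ℤ
⊝ fin q = fin (- q)
⊝ ∞     = ∞

inv ∞ = fin 0ℚ
inv fin q with q ℚₚ.≟ 0ℚ
... | yes _  = ∞
... | no q≢0 = fin ((1/ q) {{ℚ.≢-nonZero q≢0}})

_⊕_ _⊖_ : ℚ → P¹ℤ → P¹ℤ
c ⊕ fin q = fin (c + q)
c ⊕ ∞     = ∞
c ⊖ fin q = fin (c - q)
c ⊖ ∞     = ∞

-- P¹(ℂ) = ℂ ∪ {∞}, in homogeneous coordinates: [ num ∶ den ] is the
-- point num / den, and is ∞ when den = 0.  The disjoint sum of ℂ and {∞}
-- does not carry z ↦ 1 / z constructively, since z = 0 is undecidable.
record P¹ℂ : Set where
  constructor [_∶_]⟨_⟩
  field
    num den : ℂ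
    nondeg  : (num #0) ⊎ (den #0)

open P¹ℂ public

infix 4 _≈_
_≈_ : P¹ℂ → P¹ℂ → Set
p ≈ q = num p *ᶜ den q ≈ᶜ num q *ᶜ den p

finᶜ : ℂ → P¹ℂ
finᶜ z = [ z ∶ 1ᶜ ]⟨ inj₂ 1#0 ⟩

∞ᶜ : P¹ℂ
∞ᶜ = [ 1ᶜ ∶ 0ᶜ ]⟨ inj₁ 1#0 ⟩

infix  8 ⊝ᶜ_ invᶜ_
infixl 6 _⊖ᶜ_

⊝ᶜ_ invᶜ_ : P¹ℂ → P¹ℂ
⊝ᶜ p   = [ -ᶜ num p ∶ den p ]⟨ Sum.map₁ (#0-neg (num p)) (nondeg p) ⟩
invᶜ p = [ den p ∶ num p ]⟨ Sum.swap (nondeg p) ⟩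

_⊖ᶜ_ : ℂ → P¹ℂ → P¹ℂ
c ⊖ᶜ p = [ c *ᶜ den p -ᶜ num p ∶ den p ]⟨ [ cotrans , inj₂ ]′ (nondeg p) ⟩
  where
  cotrans : num p #0 → ((c *ᶜ den p -ᶜ num p) #0) ⊎ (den p #0)
  cotrans z# = Sum.swap (Sum.map₁ (#0-*ʳ c (den p)) (#0-cotrans (num p) (c *ᶜ den p) z#))

Map : Set
Map = P¹ℤ → P¹ℂ

infix 4 _≗_
_≗_ : Map → Map → Set
f ≗ g = ∀ x → f x ≈ g x

SystemA : Map → Set
SystemA f = (∀ x → f (1ℚ ⊖ inv x) ≈ 1ᶜ ⊖ᶜ invᶜ (f x))
          × (∀ x → f (⊝ inv x) ≈ ⊝ᶜ (f x))

SystemB : Map → Set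
SystemB f = (∀ x → f (1ℚ ⊖ inv x) ≈ 1ᶜ ⊖ᶜ invᶜ (f x))
          × (∀ x → f (⊝ inv (1ℚ ⊕ x)) ≈ (-ᶜ 1ᶜ) ⊖ᶜ invᶜ (f x))

TwoSolutions : (Map → Set) → ℂ → ℂ → Set
TwoSolutions System z w =
  ∃ λ f → ∃ λ g →
    System f × f (fin 1ℚ) ≈ finᶜ z ×
    System g × g (fin 1ℚ) ≈ finᶜ w ×
    ¬ (f ≗ g) ×
    (∀ h → System h → (h ≗ f) ⊎ (h ≗ g))

{-# OPTIONS --safe #-}

-- With L x = 1 - 1/x, S x = -1/x and M = S L S, system (A) is equivariance under L and S, and it
-- implies system (B), which is equivariance under L and M.  It therefore suffices to construct
-- solutions of (A) and to prove uniqueness for (B).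
--
-- Existence: every positive rational other than 1 is uniquely 1 + y = L S y or y / (1 + y) = L L S y
-- with y > 0 (Stern-Brocot), 1 = L ∞ and 0 = S ∞, and S exchanges the signs.  This forces the values of f
-- once ω = f(∞) is given, and the map so defined is equivariant because S² = L³ = 1 on both
-- sides and because ω = 1 + 1/ω matches the fact that x + 1 = L S x fixes ∞.
--
-- Uniqueness: ⟨L , M⟩ acts transitively on P¹(ℤ), so f is determined by f(∞), and L M fixes ∞, so
-- f(∞) is a fixed point of y ↦ (2y + 1) / (y + 1), that is φ or φ̄.
module Submission where

open import Defs
open import Algebra.Bundles using (CommutativeRing)
import Algebra.Properties.Group as GroupProperties
import Algebra.Solver.Ring as RingSolver
open import Algebra.Solver.Ring.AlmostCommutativeRing using (_-Raw-AlmostCommutative⟶_; fromCommutativeRing)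
open import Data.Empty using (⊥-elim)
open import Data.Integer as ℤ using (+_; +[1+_]; -[1+_])
import Data.Integer.Properties as ℤₚ
import Data.Integer.Solver as ℤSolver
import Data.Maybe as Maybe
open import Data.Nat as ℕ using (ℕ; zero; suc; compare; less; equal; greater)
import Data.Nat.Properties as ℕₚ
open import Data.Product using (Σ; ∃; _×_; _,_; proj₁; proj₂)
open import Data.Rational as ℚ using (ℚ; mkℚ; 0ℚ; 1ℚ; ½; _/_; 1/_; toℚᵘ; fromℚᵘ)
import Data.Rational.Properties as ℚₚ
open import Data.Rational.Solver using (module +-*-Solver)
open import Data.Rational.Unnormalised as ℚᵘ using (mkℚᵘ)
import Data.Rational.Unnormalised.Properties as ℚᵘₚ
open import Data.Sum as Sum using (_⊎_; inj₁; inj₂; [_,_]′)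
open import Function using (_∘_)
open import Relation.Binary.Bundles using (Setoid)
open import Relation.Binary.PropositionalEquality using (_≡_; _≢_; refl; sym; trans; cong; cong₂; subst; subst₂; module ≡-Reasoning)
import Relation.Binary.Reasoning.Setoid as SetoidReasoning
open import Relation.Nullary using (¬_; yes; no; contradiction)
open import Relation.Nullary.Decidable using (dec⇒maybe)

-- Polynomial identities for cross-multiplied fractions

-- Stated over an abstract ring because over ℂ itself the solver would unfold Cauchy sequences.
module RingIdentities {c ℓ} (R : CommutativeRing c ℓ)
  (ι : ℚ.+-*-rawRing -Raw-AlmostCommutative⟶ fromCommutativeRing R) where

  open CommutativeRing R hiding (refl; sym; trans; zero) renaming (_≈_ to _≋_)
  open _-Raw-AlmostCommutative⟶_ ι using () renaming (⟦_⟧ to κ)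
  open GroupProperties +-group using (x∙y⁻¹≈ε⇒x≈y; x≈y⇒x∙y⁻¹≈ε)
  open RingSolver ℚ.+-*-rawRing (fromCommutativeRing R) ι
    (λ p q → Maybe.map (λ p≡q → reflexive (cong κ p≡q)) (dec⇒maybe (p ℚₚ.≟ q)))
  private
    module R = CommutativeRing R

  -- The solver proves only unconditional identities. A conclusion under a hypothesis is therefore
  -- certified by writing the difference of its sides as a multiple `k` of the difference of the
  -- sides of the hypothesis.
  combine₁ : ∀ {a b c d} k → a - b ≋ k * (c - d) → c ≋ d → a ≋ b
  combine₁ {a} {b} k e c≋d = x∙y⁻¹≈ε⇒x≈y a b (R.trans e (R.trans (*-congˡ (x≈y⇒x∙y⁻¹≈ε c≋d)) (zeroʳ k)))

  combine₂ : ∀ {a b c d c′ d′} k k′ → a - b ≋ k * (c - d) + k′ * (c′ - d′) → c ≋ d → c′ ≋ d′ → a ≋ b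
  combine₂ {a} {b} k k′ e c≋d c′≋d′ = x∙y⁻¹≈ε⇒x≈y a b (R.trans e (R.trans
    (+-cong (R.trans (*-congˡ (x≈y⇒x∙y⁻¹≈ε c≋d)) (zeroʳ k)) (R.trans (*-congˡ (x≈y⇒x∙y⁻¹≈ε c′≋d′)) (zeroʳ k′)))
    (+-identityˡ 0#)))

  cross-neg : ∀ n d n′ d′ → n * d′ ≋ n′ * d → - n * d′ ≋ - n′ * d
  cross-neg n d n′ d′ = combine₁ (- κ 1ℚ) (solve 4
    (λ n d n′ d′ → :- n :* d′ :- :- n′ :* d := :- con 1ℚ :* (n :* d′ :- n′ :* d)) R.refl n d n′ d′)

  cross-inv : ∀ n d n′ d′ → n * d′ ≋ n′ * d → d * n′ ≋ d′ * n
  cross-inv n d n′ d′ = combine₁ (- κ 1ℚ) (solve 4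
    (λ n d n′ d′ → d :* n′ :- d′ :* n := :- con 1ℚ :* (n :* d′ :- n′ :* d)) R.refl n d n′ d′)

  cross-sub : ∀ c n d n′ d′ → n * d′ ≋ n′ * d → (c * d - n) * d′ ≋ (c * d′ - n′) * d
  cross-sub c n d n′ d′ = combine₁ (- κ 1ℚ) (solve 5
    (λ c n d n′ d′ → (c :* d :- n) :* d′ :- (c :* d′ :- n′) :* d := :- con 1ℚ :* (n :* d′ :- n′ :* d)) R.refl c n d n′ d′)

  -- Cross-multiplied equality is transitive only after cancelling a coordinate of the middle point.
  -- This version serves when `d₂` is apart from 0, `cross-trans-num` when `n₂` is.
  cross-trans-den : ∀ n₁ d₁ n₂ d₂ n₃ d₃ → n₁ * d₂ ≋ n₂ * d₁ → n₂ * d₃ ≋ n₃ * d₂ → d₂ * (n₁ * d₃ - n₃ * d₁) ≋ κ 0ℚ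
  cross-trans-den n₁ d₁ n₂ d₂ n₃ d₃ = combine₂ d₃ d₁ (solve 6
    (λ n₁ d₁ n₂ d₂ n₃ d₃ → d₂ :* (n₁ :* d₃ :- n₃ :* d₁) :- con 0ℚ
      := d₃ :* (n₁ :* d₂ :- n₂ :* d₁) :+ d₁ :* (n₂ :* d₃ :- n₃ :* d₂)) R.refl n₁ d₁ n₂ d₂ n₃ d₃)

  cross-trans-num : ∀ n₁ d₁ n₂ d₂ n₃ d₃ → n₁ * d₂ ≋ n₂ * d₁ → n₂ * d₃ ≋ n₃ * d₂ → n₂ * (n₁ * d₃ - n₃ * d₁) ≋ κ 0ℚ
  cross-trans-num n₁ d₁ n₂ d₂ n₃ d₃ = combine₂ n₃ n₁ (solve 6
    (λ n₁ d₁ n₂ d₂ n₃ d₃ → n₂ :* (n₁ :* d₃ :- n₃ :* d₁) :- con 0ℚ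
      := n₃ :* (n₁ :* d₂ :- n₂ :* d₁) :+ n₁ :* (n₂ :* d₃ :- n₃ :* d₂)) R.refl n₁ d₁ n₂ d₂ n₃ d₃)

  x-y≋0⇒x≋y : ∀ x y → x - y ≋ κ 0ℚ → x ≋ y
  x-y≋0⇒x≋y x y = combine₁ (κ 1ℚ) (solve 2
    (λ x y → x :- y := con 1ℚ :* (x :- y :- con 0ℚ)) R.refl x y)

  x≋y⇒x-y≋0 : ∀ x y → x ≋ y → x - y ≋ κ 0ℚ
  x≋y⇒x-y≋0 x y = combine₁ (κ 1ℚ) (solve 2
    (λ x y → x :- y :- con 0ℚ := con 1ℚ :* (x :- y)) R.refl x y)

  y≋x-[x-y] : ∀ x y → y ≋ x - (x - y)
  y≋x-[x-y] = solve 2 (λ x y → y := x :- (x :- y)) R.refl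

  S²-identity : ∀ n d → n * d ≋ - (- n) * d
  S²-identity = solve 2 (λ n d → n :* d := :- (:- n) :* d) R.refl

  -- `Lᶜ` sends `[ n ∶ d ]` to `[ n - d ∶ n ]`, so the iterates are `[ x ∶ n ]`, `[ y ∶ x ]` and
  -- `[ y - x ∶ y ]`, and the last is `[ - n ∶ - d ]`.
  L³-identity : ∀ n d → let x = κ 1ℚ * n - d; y = κ 1ℚ * x - n in (κ 1ℚ * y - x) * d ≋ n * y
  L³-identity = solve 2 (λ n d → let x = con 1ℚ :* n :- d; y = con 1ℚ :* x :- n in
    (con 1ℚ :* y :- x) :* d := n :* y) R.refl

  SLS-identity : ∀ n d → - (κ 1ℚ * - n - d) * n ≋ (- κ 1ℚ * n - d) * - n
  SLS-identity = solve 2 (λ n d → :- (con 1ℚ :* :- n :- d) :* n := (:- con 1ℚ :* n :- d) :* :- n) R.refl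

  -- On the target, S is negation and L S is z ↦ 1 + 1/z, whose fixed points are the roots of ω² = ω
  -- + 1.
  LS-identity : ∀ ω → ω * ω ≋ ω + κ 1ℚ → (κ 1ℚ * - ω - κ 1ℚ) * κ 1ℚ ≋ ω * - ω
  LS-identity ω = combine₁ (κ 1ℚ) (solve 1
    (λ ω → (con 1ℚ :* :- ω :- con 1ℚ) :* con 1ℚ :- ω :* :- ω := con 1ℚ :* (ω :* ω :- (ω :+ con 1ℚ))) R.refl ω)

  n-ωd≋0⇒n/d≋ω : ∀ ω n d → n - ω * d ≋ κ 0ℚ → n * κ 1ℚ ≋ ω * d
  n-ωd≋0⇒n/d≋ω ω n d = combine₁ (κ 1ℚ) (solve 3
    (λ ω n d → n :* con 1ℚ :- ω :* d := con 1ℚ :* (n :- ω :* d :- con 0ℚ)) R.refl ω n d)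

  module GoldenRatio (s : Carrier) (s²≋5 : s * s ≋ κ (+ 5 / 1)) where

    φₛ φ̄ₛ : Carrier
    φₛ = κ ½ * (κ 1ℚ + s)
    φ̄ₛ = κ ½ * (κ 1ℚ - s)

    private
      :φ :φ̄ : ∀ {n} → Polynomial n → Polynomial n
      :φ s = con ½ :* (con 1ℚ :+ s)
      :φ̄ s = con ½ :* (con 1ℚ :- s)

      :5 :3 ¼ :⅕ ⅛ : ∀ {n} → Polynomial n
      :5 = con (+ 5 / 1)
      :3 = con (+ 3 / 1)
      ¼ = con (+ 1 / 4)
      :⅕ = con (+ 1 / 5)
      ⅛ = con (+ 1 / 8)

    φ²≋ : φₛ * φₛ ≋ κ ½ * (κ (+ 3 / 1) + s)
    φ²≋ = combine₁ (κ (+ 1 / 4)) (solve 1 (λ s → :φ s :* :φ s :- con ½ :* (:3 :+ s) := ¼ :* (s :* s :- :5)) R.refl s) s²≋5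

    φ̄²≋ : φ̄ₛ * φ̄ₛ ≋ κ ½ * (κ (+ 3 / 1) - s)
    φ̄²≋ = combine₁ (κ (+ 1 / 4)) (solve 1 (λ s → :φ̄ s :* :φ̄ s :- con ½ :* (:3 :- s) := ¼ :* (s :* s :- :5)) R.refl s) s²≋5

    φ²≋φ+1 : φₛ * φₛ ≋ φₛ + κ 1ℚ
    φ²≋φ+1 = combine₁ (κ (+ 1 / 4)) (solve 1 (λ s → :φ s :* :φ s :- (:φ s :+ con 1ℚ) := ¼ :* (s :* s :- :5)) R.refl s) s²≋5

    φ̄²≋φ̄+1 : φ̄ₛ * φ̄ₛ ≋ φ̄ₛ + κ 1ℚ
    φ̄²≋φ̄+1 = combine₁ (κ (+ 1 / 4)) (solve 1 (λ s → :φ̄ s :* :φ̄ s :- (:φ̄ s :+ con 1ℚ) := ¼ :* (s :* s :- :5)) R.refl s) s²≋5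

    -- Gives the value at 1 = L ∞ of the map with value φ at ∞: it is 1 - 1/φ, which is φ̄² and not
    -- φ².
    Lφ≋φ̄² : (κ 1ℚ * φₛ - κ 1ℚ) * κ 1ℚ ≋ (φ̄ₛ * φ̄ₛ) * φₛ
    Lφ≋φ̄² = combine₁ (κ (+ 1 / 8) * (κ 1ℚ - s)) (solve 1
      (λ s → (con 1ℚ :* :φ s :- con 1ℚ) :* con 1ℚ :- (:φ̄ s :* :φ̄ s) :* :φ s
        := ⅛ :* (con 1ℚ :- s) :* (s :* s :- :5)) R.refl s) s²≋5

    Lφ̄≋φ² : (κ 1ℚ * φ̄ₛ - κ 1ℚ) * κ 1ℚ ≋ (φₛ * φₛ) * φ̄ₛ
    Lφ̄≋φ² = combine₁ (κ (+ 1 / 8) * (κ 1ℚ + s)) (solve 1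
      (λ s → (con 1ℚ :* :φ̄ s :- con 1ℚ) :* con 1ℚ :- (:φ s :* :φ s) :* :φ̄ s
        := ⅛ :* (con 1ℚ :+ s) :* (s :* s :- :5)) R.refl s) s²≋5

    -- M sends `[ n ∶ d ]` to `[ m ∶ n ]`, and L sends that to `[ m - n ∶ m ]`. The fixed-point
    -- equation amounts to n² - nd - d² = 0, which factors over the golden ratio.
    LM-fixed⇒quadratic : ∀ n d → let m = - κ 1ℚ * n - d in
      n * m ≋ (κ 1ℚ * m - n) * d → (n - φₛ * d) * (n - φ̄ₛ * d) ≋ κ 0ℚ
    LM-fixed⇒quadratic n d fixed = combine₂ (- κ 1ℚ) (- κ (+ 1 / 4) * (d * d)) (solve 3
      (λ s n d → let m = :- con 1ℚ :* n :- d in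
        (n :- :φ s :* d) :* (n :- :φ̄ s :* d) :- con 0ℚ
        := :- con 1ℚ :* (n :* m :- (con 1ℚ :* m :- n) :* d) :+ :- ¼ :* (d :* d) :* (s :* s :- :5)) R.refl s n d) fixed s²≋5

    -- The factor `s * κ (+ 1 / 5)` is the inverse of `s`.
    den-from-roots : ∀ n d → s * κ (+ 1 / 5) * ((n - φ̄ₛ * d) - (n - φₛ * d)) ≋ d
    den-from-roots n d = combine₁ (κ (+ 1 / 5) * d) (solve 3
      (λ s n d → s :* :⅕ :* ((n :- :φ̄ s :* d) :- (n :- :φ s :* d)) :- d := :⅕ :* d :* (s :* s :- :5)) R.refl s n d) s²≋5

    num-from-roots : ∀ n d → s * κ (+ 1 / 5) * (φₛ * (n - φ̄ₛ * d) - φ̄ₛ * (n - φₛ * d)) ≋ n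
    num-from-roots n d = combine₁ (κ (+ 1 / 5) * n) (solve 3
      (λ s n d → s :* :⅕ :* (:φ s :* (n :- :φ̄ s :* d) :- :φ̄ s :* (n :- :φ s :* d)) :- n := :⅕ :* n :* (s :* s :- :5)) R.refl s n d) s²≋5

    -- Because φ - φ̄ = s, and s times this difference is 5.
    φ≋φ̄⇒5≋0 : φₛ * κ 1ℚ ≋ φ̄ₛ * κ 1ℚ → κ (+ 5 / 1) ≋ κ 0ℚ
    φ≋φ̄⇒5≋0 e = combine₂ s (- κ 1ℚ) (solve 1
      (λ s → :5 :- con 0ℚ := s :* (:φ s :* con 1ℚ :- :φ̄ s :* con 1ℚ) :+ :- con 1ℚ :* (s :* s :- :5)) R.refl s) e s²≋5

    module FixedPoints {ℓ′} (_# : Carrier → Set ℓ′)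
      (#-resp : ∀ x y → y ≋ x → x # → y #)
      (#-cotrans : ∀ x y → x # → (y #) ⊎ ((y - x) #))
      (#-*ʳ : ∀ x y → (x * y) # → y #)
      (#-cancel : ∀ x y → x # → x * y ≋ κ 0ℚ → y ≋ κ 0ℚ) where

      -- Comparing x - y with x by cotransitivity leaves either x or x - (x - y), which is y.
      #-sub : ∀ x y → (x - y) # → (y #) ⊎ (x #)
      #-sub x y x-y# with #-cotrans (x - y) x x-y#
      ... | inj₁ x# = inj₂ x#
      ... | inj₂ y# = inj₁ (#-resp (x - (x - y)) y (y≋x-[x-y] x y) y#)

      -- Since √5 d = (n - φ̄ d) - (n - φ d), and √5 n = φ (n - φ̄ d) - φ̄ (n - φ d), the two
      -- factors cannot both vanish; this decides constructively which of them does.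
      roots-apart : ∀ n d → (n #) ⊎ (d #) → ((n - φₛ * d) #) ⊎ ((n - φ̄ₛ * d) #)
      roots-apart n d (inj₂ d#) = #-sub (n - φ̄ₛ * d) (n - φₛ * d) (#-*ʳ _ _ (#-resp _ _ (den-from-roots n d) d#))
      roots-apart n d (inj₁ n#) = Sum.map (#-*ʳ _ _) (#-*ʳ _ _)
        (#-sub (φₛ * (n - φ̄ₛ * d)) (φ̄ₛ * (n - φₛ * d)) (#-*ʳ _ _ (#-resp _ _ (num-from-roots n d) n#)))

      LM-fixed⇒root : ∀ n d → (n #) ⊎ (d #) → let m = - κ 1ℚ * n - d in
        n * m ≋ (κ 1ℚ * m - n) * d → (n * κ 1ℚ ≋ φ̄ₛ * d) ⊎ (n * κ 1ℚ ≋ φₛ * d)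
      LM-fixed⇒root n d nondeg fixed = Sum.map
        -- The factor that is apart from 0 is cancelled, so the other one vanishes: n - φ d being
        -- apart from 0 yields the root φ̄, and conversely.
        (λ a# → n-ωd≋0⇒n/d≋ω φ̄ₛ n d (#-cancel _ _ a# ab≋0))
        (λ b# → n-ωd≋0⇒n/d≋ω φₛ n d (#-cancel _ _ b# (R.trans (*-comm _ _) ab≋0)))
        (roots-apart n d nondeg)
        where
        ab≋0 = LM-fixed⇒quadratic n d fixed

open import Data.Rational using (_+_; _*_; _-_; -_; ∣_∣; _≤_; _<_)
open +-*-Solver using (solve; con; _:+_; _:*_; _:-_; :-_; _:=_)

-- Null sequences of rationals

Null : (ℕ → ℚ) → Set
Null s = ∀ ε → 0ℚ < ε → ∃ λ N → ∀ n → N ℕ.≤ n → ∣ s n ∣ ≤ ε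

Bounded : (ℕ → ℚ) → Set
Bounded s = Σ ℚ λ B → 0ℚ < B × ∃ λ N → ∀ n → N ℕ.≤ n → ∣ s n ∣ ≤ B

*-pos : ∀ {p q} → 0ℚ < p → 0ℚ < q → 0ℚ < p * q
*-pos {p} {q} 0<p 0<q = subst (_< p * q) (ℚₚ.*-zeroˡ q) (ℚₚ.*-monoˡ-<-pos q {{ℚ.positive 0<q}} 0<p)

½-pos : 0ℚ < ½
½-pos = ℚₚ.positive⁻¹ ½

divide : ∀ {B} ε → 0ℚ < B → 0ℚ < ε → Σ ℚ λ δ → 0ℚ < δ × B * δ ≡ ε
divide {B} ε 0<B 0<ε = B⁻¹ * ε , *-pos (ℚₚ.positive⁻¹ B⁻¹ {{ℚₚ.1/pos⇒pos B}}) 0<ε ,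
  trans (sym (ℚₚ.*-assoc B B⁻¹ ε)) (trans (cong (_* ε) (ℚₚ.*-inverseʳ B)) (ℚₚ.*-identityˡ ε))
  where
  instance
    B⁺ = ℚ.positive 0<B
    B≢0 = ℚₚ.pos⇒nonZero B
  B⁻¹ : ℚ
  B⁻¹ = 1/ B

null-≤ : ∀ {s t} → (∀ n → ∣ t n ∣ ≤ ∣ s n ∣) → Null s → Null t
null-≤ t≤s s→0 ε 0<ε with s→0 ε 0<ε
... | N , h = N , λ n n≥ → ℚₚ.≤-trans (t≤s n) (h n n≥)

null-cong : ∀ {s t} → (∀ n → s n ≡ t n) → Null s → Null t
null-cong s≡t = null-≤ λ n → ℚₚ.≤-reflexive (cong ∣_∣ (sym (s≡t n)))

null-0 : Null (λ _ → 0ℚ)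
null-0 ε 0<ε = 0 , λ _ _ → ℚₚ.<⇒≤ 0<ε

null-neg : ∀ {s} → Null s → Null (λ n → - s n)
null-neg {s} = null-≤ λ n → ℚₚ.≤-reflexive (ℚₚ.∣-p∣≡∣p∣ (s n))

null-+ : ∀ {s t} → Null s → Null t → Null (λ n → s n + t n)
null-+ {s} {t} s→0 t→0 ε 0<ε with s→0 (ε * ½) (*-pos 0<ε ½-pos) | t→0 (ε * ½) (*-pos 0<ε ½-pos)
... | M , hs | N , ht = M ℕ.⊔ N , λ n n≥ → begin
  ∣ s n + t n ∣     ≤⟨ ℚₚ.∣p+q∣≤∣p∣+∣q∣ (s n) (t n) ⟩
  ∣ s n ∣ + ∣ t n ∣ ≤⟨ ℚₚ.+-mono-≤ (hs n (ℕₚ.m⊔n≤o⇒m≤o M N n≥)) (ht n (ℕₚ.m⊔n≤o⇒n≤o M N n≥)) ⟩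
  ε * ½ + ε * ½     ≡⟨ solve 1 (λ e → e :* con ½ :+ e :* con ½ := e) refl ε ⟩
  ε                 ∎
  where open ℚₚ.≤-Reasoning

null-* : ∀ {s t} → Bounded s → Null t → Null (λ n → s n * t n)
null-* {s} {t} (B , 0<B , M , s≤B) t→0 ε 0<ε with divide ε 0<B 0<ε
... | δ , 0<δ , Bδ≡ε with t→0 δ 0<δ
... | N , t≤δ = M ℕ.⊔ N , λ n n≥ → begin
  ∣ s n * t n ∣     ≡⟨ ℚₚ.∣p*q∣≡∣p∣*∣q∣ (s n) (t n) ⟩
  ∣ s n ∣ * ∣ t n ∣ ≤⟨ ℚₚ.*-monoʳ-≤-nonNeg ∣ t n ∣ {{ℚₚ.∣-∣-nonNeg (t n)}} (s≤B n (ℕₚ.m⊔n≤o⇒m≤o M N n≥)) ⟩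
  B * ∣ t n ∣       ≤⟨ ℚₚ.*-monoˡ-≤-nonNeg B {{ℚₚ.pos⇒nonNeg B {{ℚ.positive 0<B}}}} (t≤δ n (ℕₚ.m⊔n≤o⇒n≤o M N n≥)) ⟩
  B * δ             ≡⟨ Bδ≡ε ⟩
  ε                 ∎
  where open ℚₚ.≤-Reasoning

-- Real numbers

pointwise⇒≈ᴿ : ∀ {x y} → (∀ n → seq x n ≡ seq y n) → x ≈ᴿ y
pointwise⇒≈ᴿ {x} {y} x≡y = null-cong
  (λ n → sym (trans (cong (_- seq y n) (x≡y n)) (ℚₚ.+-inverseʳ (seq y n)))) null-0

≈ᴿ-sym : ∀ {x y} → x ≈ᴿ y → y ≈ᴿ x
≈ᴿ-sym {x} {y} p = null-cong
  (λ n → solve 2 (λ a b → :- (a :- b) := b :- a) refl (seq x n) (seq y n)) (null-neg p)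

≈ᴿ-trans : ∀ {x y z} → x ≈ᴿ y → y ≈ᴿ z → x ≈ᴿ z
≈ᴿ-trans {x} {y} {z} p q = null-cong
  (λ n → solve 3 (λ a b c → (a :- b) :+ (b :- c) := a :- c) refl (seq x n) (seq y n) (seq z n)) (null-+ p q)

+ᴿ-cong : ∀ {x x′ y y′} → x ≈ᴿ x′ → y ≈ᴿ y′ → x +ᴿ y ≈ᴿ x′ +ᴿ y′
+ᴿ-cong {x} {x′} {y} {y′} p q = null-cong
  (λ n → solve 4 (λ a b c d → (a :- b) :+ (c :- d) := (a :+ c) :- (b :+ d)) refl
    (seq x n) (seq x′ n) (seq y n) (seq y′ n)) (null-+ p q)

-ᴿ-cong : ∀ {x y} → x ≈ᴿ y → -ᴿ x ≈ᴿ -ᴿ y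
-ᴿ-cong {x} {y} p = null-cong
  (λ n → solve 2 (λ a b → :- (a :- b) := :- a :- :- b) refl (seq x n) (seq y n)) (null-neg p)

*ᴿ-cong : ∀ {x x′ y y′} → x ≈ᴿ x′ → y ≈ᴿ y′ → x *ᴿ y ≈ᴿ x′ *ᴿ y′
*ᴿ-cong {x} {x′} {y} {y′} p q = null-cong
  (λ n → solve 4 (λ a b c d → c :* (a :- b) :+ b :* (c :- d) := a :* c :- b :* d) refl
    (seq x n) (seq x′ n) (seq y n) (seq y′ n))
  (null-+ (null-* (eventually-bounded y) p) (null-* (eventually-bounded x′) q))

#0ᴿ-cancel : ∀ {x y} → x #0ᴿ → x *ᴿ y ≈ᴿ ratᴿ 0ℚ → y ≈ᴿ ratᴿ 0ℚ
-- Precision `δ * ε` is requested for the product because ∣x∣ ≥ δ eventually, and dividing by δ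
-- leaves ε.
#0ᴿ-cancel {x} {y} (δ , 0<δ , M , δ≤x) xy≈0 ε 0<ε with xy≈0 (δ * ε) (*-pos 0<δ 0<ε)
... | N , xy≤ = M ℕ.⊔ N , λ n n≥ → ℚₚ.*-cancelˡ-≤-pos δ {{ℚ.positive 0<δ}} (begin
  δ * ∣ seq y n - 0ℚ ∣           ≤⟨ ℚₚ.*-monoʳ-≤-nonNeg ∣ seq y n - 0ℚ ∣ {{ℚₚ.∣-∣-nonNeg (seq y n - 0ℚ)}}
                                      (δ≤x n (ℕₚ.m⊔n≤o⇒m≤o M N n≥)) ⟩
  ∣ seq x n ∣ * ∣ seq y n - 0ℚ ∣ ≡⟨ sym (ℚₚ.∣p*q∣≡∣p∣*∣q∣ (seq x n) (seq y n - 0ℚ)) ⟩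
  ∣ seq x n * (seq y n - 0ℚ) ∣   ≡⟨ cong ∣_∣ (solve 2 (λ a b → a :* (b :- con 0ℚ) := a :* b :- con 0ℚ) refl (seq x n) (seq y n)) ⟩
  ∣ seq x n * seq y n - 0ℚ ∣     ≤⟨ xy≤ n (ℕₚ.m⊔n≤o⇒n≤o M N n≥) ⟩
  δ * ε                          ∎)
  where open ℚₚ.≤-Reasoning

#0ᴿ⇒≉0 : ∀ {x} → x #0ᴿ → ¬ (x ≈ᴿ ratᴿ 0ℚ)
#0ᴿ⇒≉0 {x} (δ , 0<δ , M , δ≤x) x≈0 with x≈0 (δ * ½) (*-pos 0<δ ½-pos)
... | N , x≤ = ℚₚ.<-irrefl refl (begin-strict
  δ * ½                    ≡⟨ sym (ℚₚ.+-identityˡ (δ * ½)) ⟩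
  0ℚ + δ * ½               <⟨ ℚₚ.+-monoˡ-< (δ * ½) (*-pos 0<δ ½-pos) ⟩
  δ * ½ + δ * ½            ≡⟨ solve 1 (λ e → e :* con ½ :+ e :* con ½ := e) refl δ ⟩
  δ                        ≤⟨ δ≤x (M ℕ.⊔ N) (ℕₚ.m≤m⊔n M N) ⟩
  ∣ seq x (M ℕ.⊔ N) ∣      ≡⟨ cong ∣_∣ (sym (ℚₚ.+-identityʳ (seq x (M ℕ.⊔ N)))) ⟩
  ∣ seq x (M ℕ.⊔ N) - 0ℚ ∣ ≤⟨ x≤ (M ℕ.⊔ N) (ℕₚ.m≤n⊔m M N) ⟩
  δ * ½                    ∎)
  where open ℚₚ.≤-Reasoning

∣p∣²≡p² : ∀ p → ∣ p ∣ * ∣ p ∣ ≡ p * p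
∣p∣²≡p² p with ℚₚ.∣p∣≡p∨∣p∣≡-p p
... | inj₁ e = cong₂ _*_ e e
... | inj₂ e = trans (cong₂ _*_ e e) (solve 1 (λ a → (:- a) :* (:- a) := a :* a) refl p)

0≤p² : ∀ p → 0ℚ ≤ p * p
0≤p² p = subst (0ℚ ≤_) (trans (ℚₚ.∣p*q∣≡∣p∣*∣q∣ p p) (∣p∣²≡p² p)) (ℚₚ.0≤∣p∣ (p * p))

#0ᴿ-x²+y² : ∀ x y → x #0ᴿ → (x *ᴿ x +ᴿ y *ᴿ y) #0ᴿ
#0ᴿ-x²+y² x y (δ , 0<δ , M , δ≤x) = δ * δ , *-pos 0<δ 0<δ , M , λ n n≥ → let a = seq x n; b = seq y n in begin
  δ * δ             ≤⟨ ℚₚ.*-monoˡ-≤-nonNeg δ {{ℚₚ.pos⇒nonNeg δ {{ℚ.positive 0<δ}}}} (δ≤x n n≥) ⟩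
  δ * ∣ a ∣         ≤⟨ ℚₚ.*-monoʳ-≤-nonNeg ∣ a ∣ {{ℚₚ.∣-∣-nonNeg a}} (δ≤x n n≥) ⟩
  ∣ a ∣ * ∣ a ∣     ≡⟨ ∣p∣²≡p² a ⟩
  a * a             ≡⟨ sym (ℚₚ.+-identityʳ (a * a)) ⟩
  a * a + 0ℚ        ≤⟨ ℚₚ.+-monoʳ-≤ (a * a) (0≤p² b) ⟩
  a * a + b * b     ≡⟨ sym (ℚₚ.0≤p⇒∣p∣≡p (ℚₚ.+-mono-≤ (0≤p² a) (0≤p² b))) ⟩
  ∣ a * a + b * b ∣ ∎
  where open ℚₚ.≤-Reasoning

-- Complex numbers

pointwise⇒≈ᶜ : ∀ {z w} → (∀ n → seq (re z) n ≡ seq (re w) n) → (∀ n → seq (im z) n ≡ seq (im w) n) → z ≈ᶜ w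
pointwise⇒≈ᶜ {z} {w} p q = pointwise⇒≈ᴿ {re z} {re w} p , pointwise⇒≈ᴿ {im z} {im w} q

≈ᶜ-refl : ∀ {z} → z ≈ᶜ z
≈ᶜ-refl {z} = pointwise⇒≈ᶜ {z} {z} (λ _ → refl) (λ _ → refl)

≈ᶜ-sym : ∀ {z w} → z ≈ᶜ w → w ≈ᶜ z
≈ᶜ-sym {z} {w} (p , q) = ≈ᴿ-sym {re z} {re w} p , ≈ᴿ-sym {im z} {im w} q

≈ᶜ-trans : ∀ {z w v} → z ≈ᶜ w → w ≈ᶜ v → z ≈ᶜ v
≈ᶜ-trans {z} {w} {v} (p , q) (p′ , q′) =
  ≈ᴿ-trans {re z} {re w} {re v} p p′ , ≈ᴿ-trans {im z} {im w} {im v} q q′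

+ᶜ-cong : ∀ {z z′ w w′} → z ≈ᶜ z′ → w ≈ᶜ w′ → z +ᶜ w ≈ᶜ z′ +ᶜ w′
+ᶜ-cong {z} {z′} {w} {w′} (p , q) (p′ , q′) =
  +ᴿ-cong {re z} {re z′} {re w} {re w′} p p′ , +ᴿ-cong {im z} {im z′} {im w} {im w′} q q′

-ᶜ-cong : ∀ {z w} → z ≈ᶜ w → -ᶜ z ≈ᶜ -ᶜ w
-ᶜ-cong {z} {w} (p , q) = -ᴿ-cong {re z} {re w} p , -ᴿ-cong {im z} {im w} q

*ᶜ-cong : ∀ {z z′ w w′} → z ≈ᶜ z′ → w ≈ᶜ w′ → z *ᶜ w ≈ᶜ z′ *ᶜ w′
*ᶜ-cong {a +i b} {a′ +i b′} {c +i d} {c′ +i d′} (p , q) (p′ , q′) =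
  +ᴿ-cong {a *ᴿ c} {a′ *ᴿ c′} { -ᴿ (b *ᴿ d)} { -ᴿ (b′ *ᴿ d′)} (*ᴿ-cong {a} {a′} {c} {c′} p p′)
    (-ᴿ-cong {b *ᴿ d} {b′ *ᴿ d′} (*ᴿ-cong {b} {b′} {d} {d′} q q′)) ,
  +ᴿ-cong {a *ᴿ d} {a′ *ᴿ d′} {b *ᴿ c} {b′ *ᴿ c′} (*ᴿ-cong {a} {a′} {d} {d′} p q′) (*ᴿ-cong {b} {b′} {c} {c′} q p′)

+ᶜ-*ᶜ-commutativeRing : CommutativeRing _ _
+ᶜ-*ᶜ-commutativeRing = record
  { Carrier = ℂ ; _≈_ = _≈ᶜ_ ; _+_ = _+ᶜ_ ; _*_ = _*ᶜ_ ; -_ = -ᶜ_ ; 0# = 0ᶜ ; 1# = 1ᶜ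
  ; isCommutativeRing = record
    { isRing = record
      { +-isAbelianGroup = record
        { isGroup = record
          { isMonoid = record
            { isSemigroup = record
              { isMagma = record
                { isEquivalence = record
                  { refl = λ {z} → ≈ᶜ-refl {z}
                  ; sym = λ {z} {w} → ≈ᶜ-sym {z} {w}
                  ; trans = λ {z} {w} {v} → ≈ᶜ-trans {z} {w} {v}
                  }
                ; ∙-cong = λ {z} {z′} {w} {w′} → +ᶜ-cong {z} {z′} {w} {w′}
                }
              ; assoc = λ z w v → pointwise⇒≈ᶜ {(z +ᶜ w) +ᶜ v} {z +ᶜ (w +ᶜ v)}
                  (λ n → ℚₚ.+-assoc (seq (re z) n) (seq (re w) n) (seq (re v) n))
                  (λ n → ℚₚ.+-assoc (seq (im z) n) (seq (im w) n) (seq (im v) n))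
              }
            ; identity =
                (λ z → pointwise⇒≈ᶜ {0ᶜ +ᶜ z} {z} (λ n → ℚₚ.+-identityˡ (seq (re z) n)) (λ n → ℚₚ.+-identityˡ (seq (im z) n))) ,
                (λ z → pointwise⇒≈ᶜ {z +ᶜ 0ᶜ} {z} (λ n → ℚₚ.+-identityʳ (seq (re z) n)) (λ n → ℚₚ.+-identityʳ (seq (im z) n)))
            }
          ; inverse =
              (λ z → pointwise⇒≈ᶜ { -ᶜ z +ᶜ z} {0ᶜ} (λ n → ℚₚ.+-inverseˡ (seq (re z) n)) (λ n → ℚₚ.+-inverseˡ (seq (im z) n))) ,
              (λ z → pointwise⇒≈ᶜ {z +ᶜ -ᶜ z} {0ᶜ} (λ n → ℚₚ.+-inverseʳ (seq (re z) n)) (λ n → ℚₚ.+-inverseʳ (seq (im z) n)))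
          ; ⁻¹-cong = λ {z} {w} → -ᶜ-cong {z} {w}
          }
        ; comm = λ z w → pointwise⇒≈ᶜ {z +ᶜ w} {w +ᶜ z}
            (λ n → ℚₚ.+-comm (seq (re z) n) (seq (re w) n)) (λ n → ℚₚ.+-comm (seq (im z) n) (seq (im w) n))
        }
      ; *-cong = λ {z} {z′} {w} {w′} → *ᶜ-cong {z} {z′} {w} {w′}
      ; *-assoc = λ z w v → pointwise⇒≈ᶜ {(z *ᶜ w) *ᶜ v} {z *ᶜ (w *ᶜ v)}
          (λ n → solve 6 (λ a b c d e f →
              (a :* c :- b :* d) :* e :- (a :* d :+ b :* c) :* f := a :* (c :* e :- d :* f) :- b :* (c :* f :+ d :* e)) refl
            (seq (re z) n) (seq (im z) n) (seq (re w) n) (seq (im w) n) (seq (re v) n) (seq (im v) n))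
          (λ n → solve 6 (λ a b c d e f →
              (a :* c :- b :* d) :* f :+ (a :* d :+ b :* c) :* e := a :* (c :* f :+ d :* e) :+ b :* (c :* e :- d :* f)) refl
            (seq (re z) n) (seq (im z) n) (seq (re w) n) (seq (im w) n) (seq (re v) n) (seq (im v) n))
      ; *-identity =
          (λ z → pointwise⇒≈ᶜ {1ᶜ *ᶜ z} {z}
            (λ n → solve 2 (λ a b → con 1ℚ :* a :- con 0ℚ :* b := a) refl (seq (re z) n) (seq (im z) n))
            (λ n → solve 2 (λ a b → con 1ℚ :* b :+ con 0ℚ :* a := b) refl (seq (re z) n) (seq (im z) n))) ,
          (λ z → pointwise⇒≈ᶜ {z *ᶜ 1ᶜ} {z}
            (λ n → solve 2 (λ a b → a :* con 1ℚ :- b :* con 0ℚ := a) refl (seq (re z) n) (seq (im z) n))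
            (λ n → solve 2 (λ a b → a :* con 0ℚ :+ b :* con 1ℚ := b) refl (seq (re z) n) (seq (im z) n)))
      ; distrib =
          (λ z w v → pointwise⇒≈ᶜ {z *ᶜ (w +ᶜ v)} {z *ᶜ w +ᶜ z *ᶜ v}
            (λ n → solve 6 (λ a b c d e f →
                a :* (c :+ e) :- b :* (d :+ f) := (a :* c :- b :* d) :+ (a :* e :- b :* f)) refl
              (seq (re z) n) (seq (im z) n) (seq (re w) n) (seq (im w) n) (seq (re v) n) (seq (im v) n))
            (λ n → solve 6 (λ a b c d e f →
                a :* (d :+ f) :+ b :* (c :+ e) := (a :* d :+ b :* c) :+ (a :* f :+ b :* e)) refl
              (seq (re z) n) (seq (im z) n) (seq (re w) n) (seq (im w) n) (seq (re v) n) (seq (im v) n))) ,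
          (λ z w v → pointwise⇒≈ᶜ {(w +ᶜ v) *ᶜ z} {w *ᶜ z +ᶜ v *ᶜ z}
            (λ n → solve 6 (λ a b c d e f →
                (c :+ e) :* a :- (d :+ f) :* b := (c :* a :- d :* b) :+ (e :* a :- f :* b)) refl
              (seq (re z) n) (seq (im z) n) (seq (re w) n) (seq (im w) n) (seq (re v) n) (seq (im v) n))
            (λ n → solve 6 (λ a b c d e f →
                (c :+ e) :* b :+ (d :+ f) :* a := (c :* b :+ d :* a) :+ (e :* b :+ f :* a)) refl
              (seq (re z) n) (seq (im z) n) (seq (re w) n) (seq (im w) n) (seq (re v) n) (seq (im v) n)))
      }
    ; *-comm = λ z w → pointwise⇒≈ᶜ {z *ᶜ w} {w *ᶜ z}
        (λ n → solve 4 (λ a b c d → a :* c :- b :* d := c :* a :- d :* b) refl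
          (seq (re z) n) (seq (im z) n) (seq (re w) n) (seq (im w) n))
        (λ n → solve 4 (λ a b c d → a :* d :+ b :* c := c :* b :+ d :* a) refl
          (seq (re z) n) (seq (im z) n) (seq (re w) n) (seq (im w) n))
    }
  }

-- Lets the solver work over ℂ with rational coefficients, whose equality is decidable while that of
-- ℂ is not.
rat-homomorphism : ℚ.+-*-rawRing -Raw-AlmostCommutative⟶ fromCommutativeRing +ᶜ-*ᶜ-commutativeRing
rat-homomorphism = record
  { ⟦_⟧    = rat
  ; +-homo = λ p q → pointwise⇒≈ᶜ {rat (p + q)} {rat p +ᶜ rat q} (λ _ → refl) (λ _ → refl)
  ; *-homo = λ p q → pointwise⇒≈ᶜ {rat (p * q)} {rat p *ᶜ rat q}
      (λ _ → solve 2 (λ a b → a :* b := a :* b :- con 0ℚ :* con 0ℚ) refl p q)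
      (λ _ → solve 2 (λ a b → con 0ℚ := a :* con 0ℚ :+ con 0ℚ :* b) refl p q)
  ; -‿homo = λ p → pointwise⇒≈ᶜ {rat (- p)} { -ᶜ rat p} (λ _ → refl) (λ _ → refl)
  ; 0-homo = ≈ᶜ-refl {0ᶜ}
  ; 1-homo = ≈ᶜ-refl {1ᶜ}
  }

#0⇒≉0 : ∀ {z} → z #0 → ¬ (z ≈ᶜ 0ᶜ)
#0⇒≉0 {z} (inj₁ z#) (p , _) = #0ᴿ⇒≉0 {re z} z# p
#0⇒≉0 {z} (inj₂ z#) (_ , q) = #0ᴿ⇒≉0 {im z} z# q

-- Multiplying z w by the conjugate of z gives (re z)² + (im z)² times w.
#0-cancel : ∀ {z w} → z #0 → z *ᶜ w ≈ᶜ 0ᶜ → w ≈ᶜ 0ᶜ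
#0-cancel {a +i b} {c +i d} z# (p , q) =
  #0ᴿ-cancel {N} {c} N#0 (null-cong
    (λ n → solve 4 (λ a b c d → a :* (a :* c :- b :* d :- con 0ℚ) :+ b :* (a :* d :+ b :* c :- con 0ℚ)
                                := (a :* a :+ b :* b) :* c :- con 0ℚ) refl (seq a n) (seq b n) (seq c n) (seq d n))
    (null-+ (null-* (eventually-bounded a) p) (null-* (eventually-bounded b) q))) ,
  #0ᴿ-cancel {N} {d} N#0 (null-cong
    (λ n → solve 4 (λ a b c d → a :* (a :* d :+ b :* c :- con 0ℚ) :+ :- (b :* (a :* c :- b :* d :- con 0ℚ))
                                := (a :* a :+ b :* b) :* d :- con 0ℚ) refl (seq a n) (seq b n) (seq c n) (seq d n))
    (null-+ (null-* (eventually-bounded a) q) (null-neg (null-* (eventually-bounded b) p))))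
  where
  N : ℝ
  N = a *ᴿ a +ᴿ b *ᴿ b
  swap : (b *ᴿ b +ᴿ a *ᴿ a) #0ᴿ → N #0ᴿ
  swap (δ , 0<δ , M , h) = δ , 0<δ , M , λ n n≥ →
    subst (λ t → δ ≤ ∣ t ∣) (ℚₚ.+-comm (seq b n * seq b n) (seq a n * seq a n)) (h n n≥)
  N#0 : N #0ᴿ
  N#0 = [ #0ᴿ-x²+y² a b , (λ b# → swap (#0ᴿ-x²+y² b a b#)) ]′ z#

-- Fractions

-- A fraction `m / suc d` is by definition `fromℚᵘ (mkℚᵘ m d)`, so fraction arithmetic can be moved
-- to unnormalised rationals, where equality is an integer cross product.
fromℚᵘ-homo-+ : ∀ p q → fromℚᵘ p + fromℚᵘ q ≡ fromℚᵘ (p ℚᵘ.+ q)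
fromℚᵘ-homo-+ p q = ℚₚ.toℚᵘ-injective (begin
  toℚᵘ (fromℚᵘ p + fromℚᵘ q)            ≈⟨ ℚₚ.toℚᵘ-homo-+ (fromℚᵘ p) (fromℚᵘ q) ⟩
  toℚᵘ (fromℚᵘ p) ℚᵘ.+ toℚᵘ (fromℚᵘ q) ≈⟨ ℚᵘₚ.+-cong (ℚₚ.toℚᵘ-fromℚᵘ p) (ℚₚ.toℚᵘ-fromℚᵘ q) ⟩
  p ℚᵘ.+ q                              ≈⟨ ℚᵘₚ.≃-sym (ℚₚ.toℚᵘ-fromℚᵘ (p ℚᵘ.+ q)) ⟩
  toℚᵘ (fromℚᵘ (p ℚᵘ.+ q))              ∎)
  where open SetoidReasoning ℚᵘₚ.≃-setoid

fromℚᵘ-homo-* : ∀ p q → fromℚᵘ p * fromℚᵘ q ≡ fromℚᵘ (p ℚᵘ.* q)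
fromℚᵘ-homo-* p q = ℚₚ.toℚᵘ-injective (begin
  toℚᵘ (fromℚᵘ p * fromℚᵘ q)            ≈⟨ ℚₚ.toℚᵘ-homo-* (fromℚᵘ p) (fromℚᵘ q) ⟩
  toℚᵘ (fromℚᵘ p) ℚᵘ.* toℚᵘ (fromℚᵘ q) ≈⟨ ℚᵘₚ.*-cong (ℚₚ.toℚᵘ-fromℚᵘ p) (ℚₚ.toℚᵘ-fromℚᵘ q) ⟩
  p ℚᵘ.* q                              ≈⟨ ℚᵘₚ.≃-sym (ℚₚ.toℚᵘ-fromℚᵘ (p ℚᵘ.* q)) ⟩
  toℚᵘ (fromℚᵘ (p ℚᵘ.* q))              ∎)
  where open SetoidReasoning ℚᵘₚ.≃-setoid

fromℚᵘ-mono-≤ : ∀ {p q} → p ℚᵘ.≤ q → fromℚᵘ p ≤ fromℚᵘ q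
fromℚᵘ-mono-≤ {p} {q} p≤q = ℚₚ.toℚᵘ-cancel-≤
  (ℚᵘₚ.≤-respʳ-≃ (ℚᵘₚ.≃-sym (ℚₚ.toℚᵘ-fromℚᵘ q)) (ℚᵘₚ.≤-respˡ-≃ (ℚᵘₚ.≃-sym (ℚₚ.toℚᵘ-fromℚᵘ p)) p≤q))

/-+ : ∀ m n d → m / suc d + n / suc d ≡ (m ℤ.+ n) / suc d
/-+ m n d = trans (fromℚᵘ-homo-+ (mkℚᵘ m d) (mkℚᵘ n d)) (ℚₚ.fromℚᵘ-cong {mkℚᵘ m d ℚᵘ.+ mkℚᵘ n d} {mkℚᵘ (m ℤ.+ n) d} (ℚᵘ.*≡* (begin
  (m ℤ.* D ℤ.+ n ℤ.* D) ℤ.* D      ≡⟨ Z.solve 3 (λ m n D → (m Z.:* D Z.:+ n Z.:* D) Z.:* D Z.:= (m Z.:+ n) Z.:* (D Z.:* D)) refl m n D ⟩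
  (m ℤ.+ n) ℤ.* (D ℤ.* D)          ≡⟨ cong ((m ℤ.+ n) ℤ.*_) (sym (ℤₚ.pos-* (suc d) (suc d))) ⟩
  (m ℤ.+ n) ℤ.* + (suc d ℕ.* suc d) ∎)))
  where
  open ≡-Reasoning
  module Z = ℤSolver.+-*-Solver
  D : ℤ.ℤ
  D = + suc d

-- Square roots

1/n-null : Null (λ n → + 1 / suc n)
-- Here ε = (p + 1) / (d + 1) ≥ 1 / (d + 1), so the threshold is `d` itself.
1/n-null (mkℚ +[1+ p ] d c) _ = d , λ n d≤n → ℚₚ.≤-trans
  (ℚₚ.≤-reflexive (ℚₚ.0≤p⇒∣p∣≡p (ℚₚ.nonNegative⁻¹ (+ 1 / suc n) {{ℚₚ.normalize-nonNeg 1 (suc n)}})))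
  (ℚₚ.≤-trans (fromℚᵘ-mono-≤ {mkℚᵘ (+ 1) n} {mkℚᵘ +[1+ p ] d} (ℚᵘ.*≤* (subst₂ ℤ._≤_ (ℤₚ.pos-* 1 (suc d)) (ℤₚ.pos-* (suc p) (suc n))
      (ℤ.+≤+ (ℕₚ.*-mono-≤ {1} {suc p} (ℕ.s≤s ℕ.z≤n) (ℕ.s≤s d≤n))))))
    (ℚₚ.≤-reflexive (ℚₚ.fromℚᵘ-toℚᵘ (mkℚ +[1+ p ] d c))))
1/n-null (mkℚ (+ 0) d c) 0<ε = contradiction (ℚ.positive 0<ε) λ ()
1/n-null (mkℚ -[1+ p ] d c) 0<ε = contradiction (ℚ.positive 0<ε) λ ()

square-≤ : ∀ a k n → a ℕ.* a ℕ.≤ k ℕ.* (suc n ℕ.* suc n) → (+ a / suc n) * (+ a / suc n) ≤ + k / 1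
square-≤ a k n h = subst (_≤ + k / 1) (sym (fromℚᵘ-homo-* (mkℚᵘ (+ a) n) (mkℚᵘ (+ a) n)))
  (fromℚᵘ-mono-≤ {mkℚᵘ (+ a) n ℚᵘ.* mkℚᵘ (+ a) n} {mkℚᵘ (+ k) 0} (ℚᵘ.*≤* (subst₂ ℤ._≤_
    (trans (ℤₚ.pos-* a a) (sym (ℤₚ.*-identityʳ (+ a ℤ.* + a)))) (ℤₚ.pos-* k (suc n ℕ.* suc n)) (ℤ.+≤+ h))))

≤-square : ∀ a k n → k ℕ.* (suc n ℕ.* suc n) ℕ.≤ a ℕ.* a → + k / 1 ≤ (+ a / suc n) * (+ a / suc n)
≤-square a k n h = subst (+ k / 1 ≤_) (sym (fromℚᵘ-homo-* (mkℚᵘ (+ a) n) (mkℚᵘ (+ a) n)))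
  (fromℚᵘ-mono-≤ {mkℚᵘ (+ k) 0} {mkℚᵘ (+ a) n ℚᵘ.* mkℚᵘ (+ a) n} (ℚᵘ.*≤* (subst₂ ℤ._≤_
    (ℤₚ.pos-* k (suc n ℕ.* suc n)) (trans (ℤₚ.pos-* a a) (sym (ℤₚ.*-identityʳ (+ a ℤ.* + a)))) (ℤ.+≤+ h))))

-- With a = √-approx k n and e = 1 / (n + 1): a² ≤ k ≤ (a + e)², so |a² - k| ≤ (2a + e) e.
√-square : ∀ k → √ k *ᴿ √ k ≈ᴿ ratᴿ (+ k / 1)
√-square k = null-≤ {λ n → (a n + a n + e n) * e n} bound
  (null-cong (λ n → sym (solve 2 (λ a e → (a :+ a :+ e) :* e := (a :+ a) :* e :+ e :* e) refl (a n) (e n)))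
    (null-+ (null-* (eventually-bounded (√ k +ᴿ √ k)) 1/n-null)
            -- Nullity at ε = 1 doubles as the proof that `e` is bounded by 1.
            (null-* (1ℚ , ℚₚ.positive⁻¹ 1ℚ , 1/n-null 1ℚ (ℚₚ.positive⁻¹ 1ℚ)) 1/n-null)))
  where
  a e : ℕ → ℚ
  a = √-approx k
  e n = + 1 / suc n
  bound : ∀ n → ∣ a n * a n - + k / 1 ∣ ≤ ∣ (a n + a n + e n) * e n ∣
  bound n = begin
    ∣ a n * a n - K ∣                 ≡⟨ sym (ℚₚ.∣-p∣≡∣p∣ (a n * a n - K)) ⟩
    ∣ - (a n * a n - K) ∣             ≡⟨ cong ∣_∣ (solve 2 (λ x y → :- (x :- y) := y :- x) refl (a n * a n) K) ⟩
    ∣ K - a n * a n ∣                 ≡⟨ ℚₚ.0≤p⇒∣p∣≡p (ℚₚ.≤-trans (ℚₚ.≤-reflexive (sym (ℚₚ.+-inverseʳ (a n * a n))))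
                                           (ℚₚ.+-monoˡ-≤ (- (a n * a n)) lower)) ⟩
    K - a n * a n                     ≤⟨ ℚₚ.+-monoˡ-≤ (- (a n * a n)) upper ⟩
    (a n + e n) * (a n + e n) - a n * a n ≡⟨ solve 2 (λ a e → (a :+ e) :* (a :+ e) :- a :* a := (a :+ a :+ e) :* e) refl (a n) (e n) ⟩
    (a n + a n + e n) * e n           ≤⟨ p≤∣p∣ ((a n + a n + e n) * e n) ⟩
    ∣ (a n + a n + e n) * e n ∣       ∎
    where
    open ℚₚ.≤-Reasoning
    K = + k / 1
    r = ⌊√ k ℕ.* (suc n ℕ.* suc n) ⌋
    p≤∣p∣ : ∀ p → p ≤ ∣ p ∣
    p≤∣p∣ p with ℚₚ.≤-total 0ℚ p
    ... | inj₁ 0≤p = ℚₚ.≤-reflexive (sym (ℚₚ.0≤p⇒∣p∣≡p 0≤p))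
    ... | inj₂ p≤0 = ℚₚ.≤-trans p≤0 (ℚₚ.0≤∣p∣ p)
    lower : a n * a n ≤ K
    lower = square-≤ r k n (proj₁ (⌊√⌋-spec (k ℕ.* (suc n ℕ.* suc n))))
    upper : K ≤ (a n + e n) * (a n + e n)
    upper = subst (λ t → K ≤ t * t)
      (sym (trans (/-+ (+ r) (+ 1) n) (cong (λ t → + t / suc n) (ℕₚ.+-comm r 1))))
      (≤-square (suc r) k n (ℕₚ.<⇒≤ (proj₂ (⌊√⌋-spec (k ℕ.* (suc n ℕ.* suc n))))))

-- The action of PSL₂(ℤ) on P¹(ℤ)

-- The fractions (a + 1) / (b + 1) and - (a + 1) / (b + 1).
pos neg : ℕ → ℕ → P¹ℤ
pos a b = fin (+[1+ a ] / suc b)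
neg a b = fin (-[1+ a ] / suc b)

L M S : P¹ℤ → P¹ℤ
L x = 1ℚ ⊖ inv x
M x = ⊝ inv (1ℚ ⊕ x)
S x = ⊝ inv x

-- The cases range over all pairs a, b and not only those in lowest terms, so the lemmas below can
-- compute with unreduced fractions.
P¹ℤ-elim : ∀ {ℓ} (P : P¹ℤ → Set ℓ) → P ∞ → P (fin 0ℚ) → (∀ a b → P (pos a b)) → (∀ a b → P (neg a b)) → ∀ x → P x
P¹ℤ-elim P p∞ p0 p⁺ p⁻ ∞ = p∞
P¹ℤ-elim P p∞ p0 p⁺ p⁻ (fin q@(mkℚ (+ 0) d _)) = subst (P ∘ fin) (sym (ℚₚ.↥p≡0⇒p≡0 q refl)) p0
P¹ℤ-elim P p∞ p0 p⁺ p⁻ (fin q@(mkℚ +[1+ a ] d _)) = subst (P ∘ fin) (ℚₚ.↥p/↧p≡p q) (p⁺ a d)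
P¹ℤ-elim P p∞ p0 p⁺ p⁻ (fin q@(mkℚ -[1+ a ] d _)) = subst (P ∘ fin) (ℚₚ.↥p/↧p≡p q) (p⁻ a d)

inv-unique : ∀ q r → q * r ≡ 1ℚ → inv (fin q) ≡ fin r
inv-unique q r qr≡1 with q ℚₚ.≟ 0ℚ
... | yes q≡0 = contradiction (trans (sym (ℚₚ.*-zeroˡ r)) (trans (cong (_* r) (sym q≡0)) qr≡1)) λ ()
... | no q≢0  = cong fin (begin
  q⁻¹           ≡⟨ sym (ℚₚ.*-identityʳ q⁻¹) ⟩
  q⁻¹ * 1ℚ      ≡⟨ cong (q⁻¹ *_) (sym qr≡1) ⟩
  q⁻¹ * (q * r) ≡⟨ sym (ℚₚ.*-assoc q⁻¹ q r) ⟩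
  q⁻¹ * q * r   ≡⟨ cong (_* r) (ℚₚ.*-inverseˡ q {{ℚ.≢-nonZero q≢0}}) ⟩
  1ℚ * r        ≡⟨ ℚₚ.*-identityˡ r ⟩
  r             ∎)
  where
  open ≡-Reasoning
  q⁻¹ : ℚ
  q⁻¹ = (1/ q) {{ℚ.≢-nonZero q≢0}}

/-inverse : ∀ a b → (+[1+ a ] / suc b) * (+[1+ b ] / suc a) ≡ 1ℚ
/-inverse a b = trans (fromℚᵘ-homo-* (mkℚᵘ +[1+ a ] b) (mkℚᵘ +[1+ b ] a))
  (ℚₚ.fromℚᵘ-cong {mkℚᵘ +[1+ a ] b ℚᵘ.* mkℚᵘ +[1+ b ] a} {ℚᵘ.1ℚᵘ} (ℚᵘ.*≡* (trans (ℤₚ.*-identityʳ _) (trans (sym (ℤₚ.pos-* (suc a) (suc b)))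
    (trans (cong +_ (ℕₚ.*-comm (suc a) (suc b))) (sym (ℤₚ.*-identityˡ _)))))))

inv-pos : ∀ a b → inv (pos a b) ≡ pos b a
inv-pos a b = inv-unique (+[1+ a ] / suc b) (+[1+ b ] / suc a) (/-inverse a b)

inv-neg : ∀ a b → inv (neg a b) ≡ neg b a
inv-neg a b = inv-unique (-[1+ a ] / suc b) (-[1+ b ] / suc a)
  (trans (solve 2 (λ p q → (:- p) :* (:- q) := p :* q) refl (+[1+ a ] / suc b) (+[1+ b ] / suc a)) (/-inverse a b))

-‿involutive : ∀ q → - - q ≡ q
-‿involutive = solve 1 (λ q → :- :- q := q) refl

⊝-neg : ∀ a b → ⊝ neg a b ≡ pos a b
⊝-neg a b = cong fin (-‿involutive (+[1+ a ] / suc b))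

/-1 : ∀ n → +[1+ n ] / suc n ≡ 1ℚ
/-1 n = ℚₚ.fromℚᵘ-cong {mkℚᵘ +[1+ n ] n} {ℚᵘ.1ℚᵘ} (ℚᵘ.*≡* (ℤₚ.*-comm +[1+ n ] (+ 1)))

-- With entries stored minus one, `suc (a ℕ.+ b)` encodes the sum (a + 1) + (b + 1). It is also the
-- shape that `compare` gives to the larger argument, so these formulas fit the recursion as they
-- stand.
/-+⁺ : ∀ a b c → +[1+ a ] / suc c + +[1+ b ] / suc c ≡ +[1+ suc (a ℕ.+ b) ] / suc c
/-+⁺ a b c = trans (/-+ +[1+ a ] +[1+ b ] c) (cong (λ t → + t / suc c) (cong suc (ℕₚ.+-suc a b)))

1+pos : ∀ a b → 1ℚ ⊕ pos a b ≡ pos (suc (a ℕ.+ b)) b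
1+pos a b = cong fin (trans (cong (_+ +[1+ a ] / suc b) (sym (/-1 b)))
  (trans (/-+⁺ b a b) (cong (λ t → +[1+ suc t ] / suc b) (ℕₚ.+-comm b a))))

1-neg : ∀ a b → 1ℚ ⊖ neg a b ≡ pos (suc (a ℕ.+ b)) b
1-neg a b = trans (cong (λ t → fin (1ℚ + t)) (-‿involutive (+[1+ a ] / suc b))) (1+pos a b)

1-pos-< : ∀ a b → 1ℚ ⊖ pos a (suc (a ℕ.+ b)) ≡ pos b (suc (a ℕ.+ b))
1-pos-< a b = cong fin (trans
  (cong (_- x) (trans (sym (/-1 (suc (a ℕ.+ b)))) (sym (/-+⁺ a b (suc (a ℕ.+ b))))))
  (solve 2 (λ x y → (x :+ y) :- x := y) refl x y))
  where
  x y : ℚ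
  x = +[1+ a ] / suc (suc (a ℕ.+ b))
  y = +[1+ b ] / suc (suc (a ℕ.+ b))

1-pos-> : ∀ a b → 1ℚ ⊖ pos (suc (a ℕ.+ b)) a ≡ neg b a
1-pos-> a b = cong fin (trans (cong (λ t → 1ℚ - t) (trans (sym (/-+⁺ a b a)) (cong (_+ x) (/-1 a))))
  (solve 1 (λ x → con 1ℚ :- (con 1ℚ :+ x) := :- x) refl x))
  where
  x : ℚ
  x = +[1+ b ] / suc a

S-pos : ∀ a b → S (pos a b) ≡ neg b a
S-pos a b = cong ⊝_ (inv-pos a b)

S-neg : ∀ a b → S (neg a b) ≡ pos b a
S-neg a b = trans (cong ⊝_ (inv-neg a b)) (⊝-neg b a)

L-pos-≡ : ∀ n → L (pos n n) ≡ fin 0ℚ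
L-pos-≡ n = cong (λ q → L (fin q)) (/-1 n)

L-pos-< : ∀ a b → L (pos a (suc (a ℕ.+ b))) ≡ neg b a
L-pos-< a b = trans (cong (1ℚ ⊖_) (inv-pos a (suc (a ℕ.+ b)))) (1-pos-> a b)

L-pos-> : ∀ a b → L (pos (suc (a ℕ.+ b)) a) ≡ pos b (suc (a ℕ.+ b))
L-pos-> a b = trans (cong (1ℚ ⊖_) (inv-pos (suc (a ℕ.+ b)) a)) (1-pos-< a b)

L-neg : ∀ a b → L (neg a b) ≡ pos (suc (a ℕ.+ b)) a
L-neg a b = trans (cong (1ℚ ⊖_) (inv-neg a b))
  (trans (1-neg b a) (cong (λ t → pos (suc t) a) (ℕₚ.+-comm b a)))

M-pos : ∀ a b → M (pos a b) ≡ neg b (suc (a ℕ.+ b))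
M-pos a b = trans (cong S (1+pos a b)) (S-pos (suc (a ℕ.+ b)) b)

M-neg : ∀ a b → M (neg a (suc (a ℕ.+ b))) ≡ neg (suc (a ℕ.+ b)) b
M-neg a b = trans (cong S (1-pos-< a b)) (S-pos b (suc (a ℕ.+ b)))

-- Since `M x` unfolds to `S (1ℚ ⊕ x)`, this identifies M with S L S on the source.
LS≡1⊕ : ∀ x → L (S x) ≡ 1ℚ ⊕ x
LS≡1⊕ = P¹ℤ-elim (λ x → L (S x) ≡ 1ℚ ⊕ x) refl refl
  (λ a b → trans (cong L (S-pos a b)) (trans (L-neg b a)
    (trans (cong (λ t → pos (suc t) b) (ℕₚ.+-comm b a)) (sym (1+pos a b)))))
  (λ a b → trans (cong L (S-neg a b)) (cong (1ℚ ⊖_) (inv-pos b a)))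

-- The Stern-Brocot recursion

depth-< : ∀ m j {k} → m ℕ.+ suc (m ℕ.+ j) ℕ.< suc k → m ℕ.+ j ℕ.< k
depth-< m j (ℕ.s≤s h) = ℕₚ.≤-trans (ℕₚ.≤-trans (ℕ.s≤s (ℕₚ.m≤n+m (m ℕ.+ j) m)) (ℕₚ.≤-reflexive (sym (ℕₚ.+-suc m (m ℕ.+ j))))) h

depth-> : ∀ m j {k} → suc (m ℕ.+ j) ℕ.+ m ℕ.< suc k → j ℕ.+ m ℕ.< k
depth-> m j {k} h = subst (ℕ._< k) (ℕₚ.+-comm m j) (depth-< m j (subst (ℕ._< suc k) (ℕₚ.+-comm (suc (m ℕ.+ j)) m) h))

-- Passing from p / (p + q) and p′ / (p′ + q′) to p / q and p′ / q′ removes the common term p p′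
-- from both cross products.
cross-step : ∀ m j m′ j′ → suc m ℕ.* suc (suc (m′ ℕ.+ j′)) ≡ suc m′ ℕ.* suc (suc (m ℕ.+ j)) →
             suc m ℕ.* suc j′ ≡ suc m′ ℕ.* suc j
cross-step m j m′ j′ e = ℕₚ.+-cancelˡ-≡ (suc m ℕ.* suc m′) (suc m ℕ.* suc j′) (suc m′ ℕ.* suc j) (begin
  suc m ℕ.* suc m′ ℕ.+ suc m ℕ.* suc j′ ≡⟨ sym (split m m′ j′) ⟩
  suc m ℕ.* suc (suc (m′ ℕ.+ j′))       ≡⟨ e ⟩
  suc m′ ℕ.* suc (suc (m ℕ.+ j))        ≡⟨ split m′ m j ⟩
  suc m′ ℕ.* suc m ℕ.+ suc m′ ℕ.* suc j ≡⟨ cong (ℕ._+ suc m′ ℕ.* suc j) (ℕₚ.*-comm (suc m′) (suc m)) ⟩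
  suc m ℕ.* suc m′ ℕ.+ suc m′ ℕ.* suc j ∎)
  where
  open ≡-Reasoning
  split : ∀ m n j → suc m ℕ.* suc (suc (n ℕ.+ j)) ≡ suc m ℕ.* suc n ℕ.+ suc m ℕ.* suc j
  split m n j = trans (cong (λ t → suc m ℕ.* suc t) (sym (ℕₚ.+-suc n j))) (ℕₚ.*-distribˡ-+ (suc m) (suc n) (suc j))

-- A fraction below 1 differs from one that is at least 1; this rules out equal fractions taking
-- different branches of `walk`.
cross-≢ : ∀ a b a′ b′ → a ℕ.< b → b′ ℕ.≤ a′ → suc a ℕ.* suc b′ ≢ suc a′ ℕ.* suc b
cross-≢ a b a′ b′ a<b b′≤a′ e = ℕₚ.<-irrefl e (begin-strict
  suc a ℕ.* suc b′ ≤⟨ ℕₚ.*-monoʳ-≤ (suc a) (ℕ.s≤s b′≤a′) ⟩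
  suc a ℕ.* suc a′ <⟨ ℕₚ.*-monoˡ-< (suc a′) (ℕ.s≤s a<b) ⟩
  suc b ℕ.* suc a′ ≡⟨ ℕₚ.*-comm (suc b) (suc a′) ⟩
  suc a′ ℕ.* suc b ∎)
  where open ℕₚ.≤-Reasoning

m<1+m+j : ∀ m j → m ℕ.< suc (m ℕ.+ j)
m<1+m+j m j = ℕ.s≤s (ℕₚ.m≤m+n m j)

swap-sides : ∀ a b c d → a ℕ.* b ≡ c ℕ.* d → b ℕ.* a ≡ d ℕ.* c
swap-sides a b c d e = trans (ℕₚ.*-comm b a) (trans e (ℕₚ.*-comm c d))

module Walk {c} {X : Set c} (l s : X → X) (ω : X) where

  -- (a + 1) / (b + 1) is 1 = L ∞, or 1 + y = L S y, or y / (1 + y) = L L S y.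
  -- The first argument is fuel, and has to exceed a + b.
  walk : ℕ → ℕ → ℕ → X
  walk zero    a b = ω
  walk (suc k) a b with compare a b
  ... | less m j    = l (l (s (walk k m j)))
  ... | equal _     = l (ω)
  ... | greater m j = l (s (walk k j m))

  -- Every step strictly lowers a + b, so this much fuel never runs out and the default `ω` at zero
  -- fuel is never returned.
  value : ℕ → ℕ → X
  value a b = walk (suc (a ℕ.+ b)) a b

  solution : P¹ℤ → X
  solution ∞                       = ω
  solution (fin (mkℚ (+ 0) _ _))   = s (ω)
  solution (fin (mkℚ +[1+ a ] b _)) = value a b
  -- The entries are exchanged because -(a + 1) / (b + 1) is S of the reciprocal (b + 1) / (a + 1).
  solution (fin (mkℚ -[1+ a ] b _)) = s (value b a)

  -- Equal fractions take the same branch and pass to equal fractions, whatever the fuel. The two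
  -- results are thus the same word in `l` and `s` applied to `ω`, and propositional equality holds
  -- with nothing assumed about `l` and `s`.
  walk-cong : ∀ k k′ a b a′ b′ → a ℕ.+ b ℕ.< k → a′ ℕ.+ b′ ℕ.< k′ →
              suc a ℕ.* suc b′ ≡ suc a′ ℕ.* suc b → walk k a b ≡ walk k′ a′ b′
  walk-cong (suc k) (suc k′) a b a′ b′ h h′ e with compare a b | compare a′ b′
  ... | less m j | less m′ j′ = cong (l ∘ l ∘ s)
    (walk-cong k k′ m j m′ j′ (depth-< m j h) (depth-< m′ j′ h′) (cross-step m j m′ j′ e))
  ... | equal _ | equal _ = refl
  ... | greater m j | greater m′ j′ = cong (l ∘ s)
    -- Taking reciprocals turns this branch into the one below 1, so `cross-step` applies with the
    -- sides swapped.
    (walk-cong k k′ j m j′ m′ (depth-> m j h) (depth-> m′ j′ h′)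
      (swap-sides (suc m′) (suc j) (suc m) (suc j′)
        (cross-step m′ j′ m j (swap-sides (suc (suc (m ℕ.+ j))) (suc m′) (suc (suc (m′ ℕ.+ j′))) (suc m) e))))
  ... | less m j | equal n =
    ⊥-elim (cross-≢ m (suc (m ℕ.+ j)) n n (m<1+m+j m j) ℕₚ.≤-refl e)
  ... | less m j | greater m′ j′ =
    ⊥-elim (cross-≢ m (suc (m ℕ.+ j)) (suc (m′ ℕ.+ j′)) m′ (m<1+m+j m j) (ℕₚ.<⇒≤ (m<1+m+j m′ j′)) e)
  ... | equal n | less m′ j′ =
    ⊥-elim (cross-≢ m′ (suc (m′ ℕ.+ j′)) n n (m<1+m+j m′ j′) ℕₚ.≤-refl (sym e))
  ... | greater m j | less m′ j′ =
    ⊥-elim (cross-≢ m′ (suc (m′ ℕ.+ j′)) (suc (m ℕ.+ j)) m (m<1+m+j m′ j′) (ℕₚ.<⇒≤ (m<1+m+j m j)) (sym e))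
  ... | equal n | greater m′ j′ =
    ⊥-elim (cross-≢ m′ (suc (m′ ℕ.+ j′)) n n (m<1+m+j m′ j′) ℕₚ.≤-refl
      (swap-sides (suc n) (suc m′) (suc (suc (m′ ℕ.+ j′))) (suc n) e))
  ... | greater m j | equal n =
    ⊥-elim (cross-≢ m (suc (m ℕ.+ j)) n n (m<1+m+j m j) ℕₚ.≤-refl
      (sym (swap-sides (suc (suc (m ℕ.+ j))) (suc n) (suc n) (suc m) e)))

  value-cong : ∀ a b a′ b′ → suc a ℕ.* suc b′ ≡ suc a′ ℕ.* suc b → value a b ≡ value a′ b′
  value-cong a b a′ b′ = walk-cong (suc (a ℕ.+ b)) (suc (a′ ℕ.+ b′)) a b a′ b′ ℕₚ.≤-refl ℕₚ.≤-refl

  -- The shape of `b` is a separate equation so that matching on `compare a b` meets a variable.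
  walk-< : ∀ k a b j → b ≡ suc (a ℕ.+ j) → walk (suc k) a b ≡ l (l (s (walk k a j)))
  walk-< k a b j e with compare a b
  ... | less _ i    = cong (λ t → l (l (s (walk k a t)))) (ℕₚ.+-cancelˡ-≡ a i j (ℕₚ.suc-injective e))
  ... | equal _     = ⊥-elim (ℕₚ.<-irrefl e (m<1+m+j a j))
  ... | greater _ i = ⊥-elim (ℕₚ.<-irrefl e (ℕₚ.<-trans (m<1+m+j b i) (m<1+m+j a j)))

  walk-≡ : ∀ k a b → a ≡ b → walk (suc k) a b ≡ l ω
  walk-≡ k a b e with compare a b
  ... | less _ i    = ⊥-elim (ℕₚ.<-irrefl e (m<1+m+j a i))
  ... | equal _     = refl
  ... | greater _ i = ⊥-elim (ℕₚ.<-irrefl (sym e) (m<1+m+j b i))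

  walk-> : ∀ k a b j → a ≡ suc (b ℕ.+ j) → walk (suc k) a b ≡ l (s (walk k j b))
  walk-> k a b j e with compare a b
  ... | less _ i    = ⊥-elim (ℕₚ.<-irrefl e (ℕₚ.<-trans (m<1+m+j a i) (m<1+m+j b j)))
  ... | equal _     = ⊥-elim (ℕₚ.<-irrefl e (m<1+m+j b j))
  ... | greater _ i = cong (λ t → l (s (walk k t b))) (ℕₚ.+-cancelˡ-≡ b i j (ℕₚ.suc-injective e))

  value-< : ∀ a b → value a (suc (a ℕ.+ b)) ≡ l (l (s (value a b)))
  value-< a b = trans (walk-< (a ℕ.+ suc (a ℕ.+ b)) a (suc (a ℕ.+ b)) b refl)
    -- The pair is the same on both sides; `walk-cong` serves here to discard the surplus fuel.
    (cong (λ t → l (l (s t))) (walk-cong (a ℕ.+ suc (a ℕ.+ b)) (suc (a ℕ.+ b)) a b a b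
      (depth-< a b (ℕₚ.n<1+n (a ℕ.+ suc (a ℕ.+ b)))) (ℕₚ.n<1+n (a ℕ.+ b)) refl))

  value-≡ : ∀ a → value a a ≡ l ω
  value-≡ a = walk-≡ (a ℕ.+ a) a a refl

  value-> : ∀ a b → value (suc (a ℕ.+ b)) a ≡ l (s (value b a))
  value-> a b = trans (walk-> (suc (a ℕ.+ b) ℕ.+ a) (suc (a ℕ.+ b)) a b refl)
    (cong (λ t → l (s t)) (walk-cong (suc (a ℕ.+ b) ℕ.+ a) (suc (b ℕ.+ a)) b a b a
      (depth-> a b (ℕₚ.n<1+n (suc (a ℕ.+ b) ℕ.+ a))) (ℕₚ.n<1+n (b ℕ.+ a)) refl))

  private
    drop-+ : ∀ a b c d → +[1+ a ] ℤ.* + suc d ≡ +[1+ c ] ℤ.* + suc b → suc a ℕ.* suc d ≡ suc c ℕ.* suc b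
    drop-+ a b c d e = ℤₚ.+-injective
      (trans (ℤₚ.pos-* (suc a) (suc d)) (trans e (sym (ℤₚ.pos-* (suc c) (suc b)))))

    -- The quotient in `pos a b` is normalised, so its entries need not be a and b. Generalising to
    -- any equivalent `q` allows a split on its reduced form, and `value-cong` absorbs the common
    -- factor.
    solution-pos′ : ∀ q a b → toℚᵘ q ℚᵘ.≃ mkℚᵘ +[1+ a ] b → solution (fin q) ≡ value a b
    solution-pos′ (mkℚ +[1+ c ] d _) a b (ℚᵘ.*≡* e) = value-cong c d a b (drop-+ c d a b e)
    solution-pos′ (mkℚ (+ 0) d _) a b (ℚᵘ.*≡* ())
    solution-pos′ (mkℚ -[1+ c ] d _) a b (ℚᵘ.*≡* ())

    solution-neg′ : ∀ q a b → toℚᵘ q ℚᵘ.≃ mkℚᵘ -[1+ a ] b → solution (fin q) ≡ s (value b a)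
    solution-neg′ (mkℚ -[1+ c ] d _) a b (ℚᵘ.*≡* e) = cong s (value-cong d c b a
      (swap-sides (suc a) (suc d) (suc c) (suc b) (sym (drop-+ c d a b (ℤₚ.neg-injective e)))))
    solution-neg′ (mkℚ (+ 0) d _) a b (ℚᵘ.*≡* ())
    solution-neg′ (mkℚ +[1+ c ] d _) a b (ℚᵘ.*≡* ())

  solution-pos : ∀ a b → solution (pos a b) ≡ value a b
  solution-pos a b = solution-pos′ (+[1+ a ] / suc b) a b (ℚₚ.toℚᵘ-fromℚᵘ (mkℚᵘ +[1+ a ] b))

  solution-neg : ∀ a b → solution (neg a b) ≡ s (value b a)
  solution-neg a b = solution-neg′ (-[1+ a ] / suc b) a b (ℚₚ.toℚᵘ-fromℚᵘ (mkℚᵘ -[1+ a ] b))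

-- Γ = ⟨L, M⟩ acts transitively on P¹(ℤ).
Γ-induction : ∀ {p} (P : P¹ℤ → Set p) → P ∞ → (∀ x → P x → P (L x)) → (∀ x → P x → P (M x)) → ∀ x → P x
Γ-induction P P∞ PL PM = P¹ℤ-elim P P∞ (PM ∞ P∞) (λ a b → proj₁ (both (suc (a ℕ.+ b)) a b (ℕₚ.n<1+n (a ℕ.+ b))))
  (λ a b → proj₂ (both (suc (a ℕ.+ b)) a b (ℕₚ.n<1+n (a ℕ.+ b))))
  where
  -- Both signs are carried along because each conclusion draws on one of ±x, where x = (a + 1) / (b
  -- + 1): 1 + 1/x is L (-x) and -(1 + 1/x) is M (M x), while in `below` 1 / (1 + x) is L (L (-x))
  -- and -1 / (1 + x) is M x.
  above : ∀ a b → P (pos a b) × P (neg a b) → P (pos (suc (a ℕ.+ b)) a) × P (neg (suc (a ℕ.+ b)) a)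
  above a b (p⁺ , p⁻) = subst P (L-neg a b) (PL _ p⁻) ,
    subst P (trans (cong M (trans (M-pos a b) (cong (λ t → neg b (suc t)) (ℕₚ.+-comm a b))))
                   (trans (M-neg b a) (cong (λ t → neg (suc t) a) (ℕₚ.+-comm b a))))
      (PM _ (PM _ p⁺))
  below : ∀ a b → P (pos a b) × P (neg a b) → P (pos b (suc (a ℕ.+ b))) × P (neg b (suc (a ℕ.+ b)))
  below a b (p⁺ , p⁻) = subst P (trans (cong L (L-neg a b)) (L-pos-> a b)) (PL _ (PL _ p⁻)) ,
    subst P (M-pos a b) (PM _ p⁺)
  both : ∀ k a b → a ℕ.+ b ℕ.< k → P (pos a b) × P (neg a b)
  both (suc k) a b h with compare a b
  ... | less a j    = subst (λ t → P (pos a (suc t)) × P (neg a (suc t))) (ℕₚ.+-comm j a)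
    (below j a (both k j a (subst (ℕ._< k) (ℕₚ.+-comm a j) (depth-< a j h))))
  -- The base points are 1 = L ∞ and -1 = M 0 = M (M ∞).
  ... | equal a     = subst (λ t → P (fin t)) (sym (/-1 a)) (PL ∞ P∞) ,
    subst (λ t → P (fin (- t))) (sym (/-1 a)) (PM (fin 0ℚ) (PM ∞ P∞))
  ... | greater b j = above b j (both k b j (subst (ℕ._< k) (ℕₚ.+-comm j b) (depth-> b j h)))

-- Equivariant maps from P¹(ℤ)

module Equivariance {c ℓ} (X : Setoid c ℓ) (l m s : Setoid.Carrier X → Setoid.Carrier X) where

  open Setoid X using () renaming (Carrier to |X|; _≈_ to _≋_)
  private
    module X = Setoid X
  open SetoidReasoning X

  module _ (l-cong : ∀ {x y} → x ≋ y → l x ≋ l y) (s-cong : ∀ {x y} → x ≋ y → s x ≋ s y)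
           (sls≋m : ∀ x → s (l (s x)) ≋ m x) where

    L,S⇒M : ∀ {f : P¹ℤ → |X|} → (∀ x → f (L x) ≋ l (f x)) → (∀ x → f (S x) ≋ s (f x)) → ∀ x → f (M x) ≋ m (f x)
    L,S⇒M {f} fL fS x = begin
      f (M x)         ≈⟨ fS (1ℚ ⊕ x) ⟩
      s (f (1ℚ ⊕ x))  ≡⟨ cong (s ∘ f) (sym (LS≡1⊕ x)) ⟩
      s (f (L (S x))) ≈⟨ s-cong (fL (S x)) ⟩
      s (l (f (S x))) ≈⟨ s-cong (l-cong (fS x)) ⟩
      s (l (s (f x))) ≈⟨ sls≋m (f x) ⟩
      m (f x)         ∎

  module _ (l-cong : ∀ {x y} → x ≋ y → l x ≋ l y) (s² : ∀ x → x ≋ s (s x)) (l³ : ∀ x → l (l (l x)) ≋ x)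
           (ω : |X|) (lsω≋ω : l (s ω) ≋ ω) where

    open Walk l s ω

    solution-S : ∀ x → solution (S x) ≋ s (solution x)
    solution-S = P¹ℤ-elim (λ x → solution (S x) ≋ s (solution x)) X.refl (s² ω)
      (λ a b → begin
        solution (S (pos a b)) ≡⟨ trans (cong solution (S-pos a b)) (solution-neg b a) ⟩
        s (value a b)          ≡⟨ cong s (sym (solution-pos a b)) ⟩
        s (solution (pos a b)) ∎)
      (λ a b → begin
        solution (S (neg a b)) ≡⟨ trans (cong solution (S-neg a b)) (solution-pos b a) ⟩
        value b a              ≈⟨ s² (value b a) ⟩
        s (s (value b a))      ≡⟨ cong s (sym (solution-neg a b)) ⟩
        s (solution (neg a b)) ∎)

    -- Below 1 the value starts with l l s, and one more l cancels by `l³`. At 1 the claim is s ω =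
    -- l (l ω), which follows from `l³` and `lsω≋ω`. Above 1 the extra l turns l s into the l l s
    -- that the recursion assigns to the image.
    solution-L-pos : ∀ {a b} → ℕ.Ordering a b → solution (L (pos a b)) ≋ l (value a b)
    solution-L-pos (less a j) = begin
      solution (L (pos a (suc (a ℕ.+ j)))) ≡⟨ trans (cong solution (L-pos-< a j)) (solution-neg j a) ⟩
      s (value a j)                        ≈⟨ X.sym (l³ (s (value a j))) ⟩
      l (l (l (s (value a j))))            ≡⟨ cong l (sym (value-< a j)) ⟩
      l (value a (suc (a ℕ.+ j)))          ∎
    solution-L-pos (equal a) = begin
      solution (L (pos a a)) ≡⟨ cong solution (L-pos-≡ a) ⟩
      s ω                    ≈⟨ X.sym (l³ (s ω)) ⟩
      l (l (l (s ω)))        ≈⟨ l-cong (l-cong lsω≋ω) ⟩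
      l (l ω)                ≡⟨ cong l (sym (value-≡ a)) ⟩
      l (value a a)          ∎
    solution-L-pos (greater b j) = begin
      solution (L (pos (suc (b ℕ.+ j)) b)) ≡⟨ trans (cong solution (L-pos-> b j)) (solution-pos j (suc (b ℕ.+ j))) ⟩
      value j (suc (b ℕ.+ j))              ≡⟨ cong (λ t → value j (suc t)) (ℕₚ.+-comm b j) ⟩
      value j (suc (j ℕ.+ b))              ≡⟨ value-< j b ⟩
      l (l (s (value j b)))                ≡⟨ cong l (sym (value-> b j)) ⟩
      l (value (suc (b ℕ.+ j)) b)          ∎

    solution-L : ∀ x → solution (L x) ≋ l (solution x)
    -- At 0 the image is ∞ and the value at 0 is `s ω`, so the claim is exactly the fixed-point
    -- condition on `ω`.
    solution-L = P¹ℤ-elim (λ x → solution (L x) ≋ l (solution x)) X.refl (X.sym lsω≋ω)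
      (λ a b → begin
        solution (L (pos a b)) ≈⟨ solution-L-pos (compare a b) ⟩
        l (value a b)          ≡⟨ cong l (sym (solution-pos a b)) ⟩
        l (solution (pos a b)) ∎)
      (λ a b → begin
        solution (L (neg a b))    ≡⟨ trans (cong solution (L-neg a b)) (solution-pos (suc (a ℕ.+ b)) a) ⟩
        value (suc (a ℕ.+ b)) a   ≡⟨ value-> a b ⟩
        l (s (value b a))         ≡⟨ cong l (sym (solution-neg a b)) ⟩
        l (solution (neg a b))    ∎)

  -- The set of points where f and g agree contains ∞ and is closed under L and M.
  equivariant-unique : (∀ {x y} → x ≋ y → l x ≋ l y) → (∀ {x y} → x ≋ y → m x ≋ m y) →
    ∀ {f g : P¹ℤ → |X|} → (∀ x → f (L x) ≋ l (f x)) → (∀ x → f (M x) ≋ m (f x)) →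
    (∀ x → g (L x) ≋ l (g x)) → (∀ x → g (M x) ≋ m (g x)) → f ∞ ≋ g ∞ → ∀ x → f x ≋ g x
  equivariant-unique l-cong m-cong {f} {g} fL fM gL gM f∞≋g∞ = Γ-induction (λ x → f x ≋ g x) f∞≋g∞
    (λ x e → X.trans (fL x) (X.trans (l-cong e) (X.sym (gL x))))
    (λ x e → X.trans (fM x) (X.trans (m-cong e) (X.sym (gM x))))

-- The projective line over ℂ

open RingIdentities +ᶜ-*ᶜ-commutativeRing rat-homomorphism

-- By cotransitivity either w is apart from 0 or w - z is, and the latter contradicts w = z.
#0-resp : ∀ z w → w ≈ᶜ z → z #0 → w #0
#0-resp z w w≈z z# with #0-cotrans z w z#
... | inj₁ w# = w#
... | inj₂ w-z# = ⊥-elim (#0⇒≉0 {w -ᶜ z} w-z# (x≋y⇒x-y≋0 w z w≈z))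

≈-refl : ∀ p → p ≈ p
≈-refl p = ≈ᶜ-refl {num p *ᶜ den p}

≈-sym : ∀ p q → p ≈ q → q ≈ p
≈-sym p q = ≈ᶜ-sym {num p *ᶜ den q} {num q *ᶜ den p}

≈-trans : ∀ p q r → p ≈ q → q ≈ r → p ≈ r
≈-trans p q r p≈q q≈r = x-y≋0⇒x≋y (num p *ᶜ den r) (num r *ᶜ den p) ([ cancel-num , cancel-den ]′ (nondeg q))
  where
  δ : ℂ
  δ = num p *ᶜ den r -ᶜ num r *ᶜ den p
  cancel-num : num q #0 → δ ≈ᶜ 0ᶜ
  cancel-num n# = #0-cancel {num q} {δ} n# (cross-trans-num (num p) (den p) (num q) (den q) (num r) (den r) p≈q q≈r)
  cancel-den : den q #0 → δ ≈ᶜ 0ᶜ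
  cancel-den d# = #0-cancel {den q} {δ} d# (cross-trans-den (num p) (den p) (num q) (den q) (num r) (den r) p≈q q≈r)

P¹ℂ-setoid : Setoid _ _
P¹ℂ-setoid = record
  { Carrier = P¹ℂ ; _≈_ = _≈_
  ; isEquivalence = record
    { refl = λ {p} → ≈-refl p ; sym = λ {p} {q} → ≈-sym p q ; trans = λ {p} {q} {r} → ≈-trans p q r }
  }

Lᶜ Mᶜ Sᶜ : P¹ℂ → P¹ℂ
Lᶜ p = 1ᶜ ⊖ᶜ invᶜ p
Mᶜ p = (-ᶜ 1ᶜ) ⊖ᶜ invᶜ p
Sᶜ p = ⊝ᶜ p

⊖ᶜ-inv-cong : ∀ c p q → p ≈ q → c ⊖ᶜ invᶜ p ≈ c ⊖ᶜ invᶜ q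
⊖ᶜ-inv-cong c p q p≈q = cross-sub c (den p) (num p) (den q) (num q) (cross-inv (num p) (den p) (num q) (den q) p≈q)

Lᶜ-cong : ∀ p q → p ≈ q → Lᶜ p ≈ Lᶜ q
Lᶜ-cong = ⊖ᶜ-inv-cong 1ᶜ

Mᶜ-cong : ∀ p q → p ≈ q → Mᶜ p ≈ Mᶜ q
Mᶜ-cong = ⊖ᶜ-inv-cong (-ᶜ 1ᶜ)

Sᶜ-cong : ∀ p q → p ≈ q → Sᶜ p ≈ Sᶜ q
Sᶜ-cong p q = cross-neg (num p) (den p) (num q) (den q)

Sᶜ² : ∀ p → p ≈ Sᶜ (Sᶜ p)
Sᶜ² p = S²-identity (num p) (den p)

Lᶜ³ : ∀ p → Lᶜ (Lᶜ (Lᶜ p)) ≈ p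
Lᶜ³ p = L³-identity (num p) (den p)

SLSᶜ≈Mᶜ : ∀ p → Sᶜ (Lᶜ (Sᶜ p)) ≈ Mᶜ p
SLSᶜ≈Mᶜ p = SLS-identity (num p) (den p)

-- The two solutions

√5 : ℂ
√5 = real (√ 5)

√5²≈5 : √5 *ᶜ √5 ≈ᶜ rat (+ 5 / 1)
√5²≈5 = null-cong (λ n → cong (_- + 5 / 1) (sym (ℚₚ.+-identityʳ (√-approx 5 n * √-approx 5 n)))) (√-square 5) ,
  null-cong (λ n → sym (cong₂ (λ x y → x + y - 0ℚ) (ℚₚ.*-zeroʳ (√-approx 5 n)) (ℚₚ.*-zeroˡ (√-approx 5 n)))) null-0

open GoldenRatio √5 √5²≈5

5≉0 : ¬ (rat (+ 5 / 1) ≈ᶜ 0ᶜ)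
5≉0 = #0⇒≉0 {rat (+ 5 / 1)} (inj₁ (1ℚ , ℚₚ.positive⁻¹ 1ℚ , 0 , λ _ _ → ℚ.*≤* (ℤ.+≤+ (ℕ.s≤s ℕ.z≤n))))

open FixedPoints _#0 #0-resp #0-cotrans #0-*ʳ (λ z w → #0-cancel {z} {w})

LM-fixed-points : ∀ p → p ≈ Lᶜ (Mᶜ p) → (p ≈ finᶜ φ̄) ⊎ (p ≈ finᶜ φ)
LM-fixed-points p = LM-fixed⇒root (num p) (den p) (nondeg p)

open Equivariance P¹ℂ-setoid Lᶜ Mᶜ Sᶜ

systemA⇒systemB : ∀ f → SystemA f → SystemB f
systemA⇒systemB f (fL , fS) =
  fL , L,S⇒M (λ {p} {q} → Lᶜ-cong p q) (λ {p} {q} → Sᶜ-cong p q) SLSᶜ≈Mᶜ {f} fL fS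

systemB-unique : ∀ f g → SystemB f → SystemB g → f ∞ ≈ g ∞ → f ≗ g
systemB-unique f g (fL , fM) (gL , gM) =
  equivariant-unique (λ {p} {q} → Lᶜ-cong p q) (λ {p} {q} → Mᶜ-cong p q) {f} {g} fL fM gL gM

solutionAt : ℂ → Map
solutionAt ω = Walk.solution Lᶜ Sᶜ (finᶜ ω)

solutionAt-systemA : ∀ ω → ω *ᶜ ω ≈ᶜ ω +ᶜ 1ᶜ → SystemA (solutionAt ω)
solutionAt-systemA ω ω²≈ω+1 =
  solution-L (λ {p} {q} → Lᶜ-cong p q) Sᶜ² Lᶜ³ (finᶜ ω) (LS-identity ω ω²≈ω+1) ,
  solution-S (λ {p} {q} → Lᶜ-cong p q) Sᶜ² Lᶜ³ (finᶜ ω) (LS-identity ω ω²≈ω+1)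

-- Covers every system lying between (A) and (B): existence is inherited from the stronger (A),
-- uniqueness from the weaker (B).
twoSolutions : ∀ System → (∀ f → SystemA f → System f) → (∀ f → System f → SystemB f) →
               TwoSolutions System (φ *ᶜ φ) (φ̄ *ᶜ φ̄)
twoSolutions System A⇒ ⇒B = f , g , A⇒ f fA , Lφ̄≋φ² , A⇒ g gA , Lφ≋φ̄² , f≢g , unique
  where
  f g : Map
  -- The conjugates cross over: the value at 1 is 1 - 1/ω, so ω = φ̄ produces φ² and ω = φ produces
  -- φ̄².
  f = solutionAt φ̄
  g = solutionAt φ
  fA : SystemA f
  fA = solutionAt-systemA φ̄ φ̄²≋φ̄+1
  gA : SystemA g
  gA = solutionAt-systemA φ φ²≋φ+1
  f≢g : ¬ (f ≗ g)
  f≢g f≗g = 5≉0 (φ≋φ̄⇒5≋0 (≈ᶜ-sym {φ̄ *ᶜ 1ᶜ} {φ *ᶜ 1ᶜ} (f≗g ∞)))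
  unique : ∀ h → System h → (h ≗ f) ⊎ (h ≗ g)
  unique h hSys = Sum.map (systemB-unique h f hB (systemA⇒systemB f fA)) (systemB-unique h g hB (systemA⇒systemB g gA))
    (LM-fixed-points (h ∞) h∞-fixed)
    where
    hB : SystemB h
    hB = ⇒B h hSys
    h∞-fixed : h ∞ ≈ Lᶜ (Mᶜ (h ∞))
    -- Both ∞ = L 0 and 0 = M ∞ hold by computation, so the two equations of (B) chain without
    -- rewriting.
    h∞-fixed = ≈-trans (h ∞) (Lᶜ (h (fin 0ℚ))) (Lᶜ (Mᶜ (h ∞)))
      (proj₁ hB (fin 0ℚ)) (Lᶜ-cong (h (fin 0ℚ)) (Mᶜ (h ∞)) (proj₂ hB ∞))

mainTheorem10 : (φ *ᶜ φ ≈ᶜ rat ½ *ᶜ (rat (+ 3 / 1) +ᶜ real (√ 5))) ×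
    (φ̄ *ᶜ φ̄ ≈ᶜ rat ½ *ᶜ (rat (+ 3 / 1) -ᶜ real (√ 5))) ×
    TwoSolutions SystemA (φ *ᶜ φ) (φ̄ *ᶜ φ̄) ×
    TwoSolutions SystemB (φ *ᶜ φ) (φ̄ *ᶜ φ̄)
mainTheorem10 = φ²≋ , φ̄²≋ , twoSolutions SystemA (λ _ A → A) systemA⇒systemB , twoSolutions SystemB systemA⇒systemB (λ _ B → B)
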